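{- Let $\mathbb B$ be a complete Boolean algebra and $U$ an ultrafilter on $\mathbb B$ such that the Boolean ultrapower by $U$ is well-founded. Suppose that there is a simple skeleton for $(\mathbb B,U)$. Then \[\mathrm V^{\mathbb B}/U=\bigcap_{A\text{ simple}}M_A,\] where $A$ ranges over the simple maximal antichains of $\mathbb B$. If, further, every maximal antichain in $\mathbb B$ is simple, then \[\mathrm V^{\mathbb B}/U=\bigcap_{A}M_A,\] where $A$ ranges over all maximal antichains of $\mathbb B$.
   Context: Let $U\in\mathrm V$ be an ultrafilter on $\mathbb B$. $\mathrm V^{\mathbb B}/U$ consists of the classes $[\sigma]_U$ of $\mathbb B$-names under $\sigma\sim\tau$ iff $[\![\sigma=\tau]\!]\in U$, with $[\sigma]_U\,E\,[\tau]_U$ iff $[\![\sigma\in\tau]\!]\in U$. The Boolean ultrapower $\check{\mathrm V}_U\subseteq\mathrm V^{\mathbb B}/U$ consists of the classes of names with $[\![\sigma\in\check{\mathrm V}]\!]=\bigvee_{x\in\mathrm V}[\![\sigma=\check x]\!]\in U$, and $j:\mathrm V\to\check{\mathrm V}_U$, $j(x)=[\check x]_U$, is the Boolean ultrapower embedding. $\dot G$ is the canonical name for the generic filter and $G=[\dot G]_U$; $G$ is $j(\mathbb B)$-generic over $\check{\mathrm V}_U$ and $\check{\mathrm V}_U[G]=\mathrm V^{\mathbb B}/U$. In the well-founded case all these models are taken to be transitive. For a maximal antichain $A\subseteq\mathbb B$ (of nonzero elements), $U_A=\{X\subseteq A\mid\bigvee X\in U\}$, $M_A$ is the (transitive) ultrapower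 of $\mathrm V$ by $U_A$, $\pi_{0,A}:\mathrm V\to M_A$ is the ultrapower embedding, and $b_A$ is the unique element of $j(A)\cap G$. $B\le^*A$ ($B$ refines $A$) means every $b\in B$ is below some $a\in A$; then $\pi_{A,B}:M_A\to M_B$ sends $[f]_{U_A}$ to the class of $b\mapsto f(a)$, $a\in A$ unique with $b\le a$. $\check{\mathrm V}_U$ is the direct limit of this system, with direct limit maps $\pi_{A,\infty}:M_A\to\check{\mathrm V}_U$, $\pi_{A,\infty}([f]_{U_A})=j(f)(b_A)$. Let $G_A=\pi_{A,\infty}^{ -1}[G]$. The antichain $A$ is simple (with respect to $U$) if $G_A\in M_A$. A skeleton for $(\mathbb B,U)$ is a set $\mathfrak A$ of maximal antichains of $\mathbb B$ such that (1) $\mathfrak A$ is directed under refinement (any two members have a common refinement in $\mathfrak A$), (2) $j[\mathfrak A]=\{j(A)\mid A\in\mathfrak A\}\in\mathrm V^{\mathbb B}/U$, and (3) $\check{\mathrm V}_U=\{j(f)(b_A)\mid A\in\mathfrak A,\ f:A\to\mathrm V\}$. It is simple if every $A\in\mathfrak A$ is simple. -}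

module Defs where

open import Data.Bool using (Bool; if_then_else_)
open import Data.Product using (Σ; Σ-syntax; ∃; ∃-syntax; _×_; _,_; proj₁; proj₂)
open import Data.Sum using (_⊎_)
open import Function.Base using (_∘_; id)
open import Function.Bundles using (_⇔_)
open import Induction.WellFounded using (WellFounded)
open import Level using (Level; suc; _⊔_; Lift; lower)
open import Relation.Binary.Core using (Rel)
open import Relation.Binary.Definitions using (_Respects_)
open import Relation.Binary.Lattice.Bundles using (BooleanAlgebra)
open import Relation.Nullary using (¬_)
open import Relation.Unary using (Pred; _∈_; _⊆_)

-- The universe V is Aczel's cumulative hierarchy over Set ℓ.  Excluded middle
-- together with AxiomOfChoice below makes it a model of ZFC.  A V-set is a
-- small family, so "I-indexed family with I : Set ℓ" is how sets of anything
-- are expressed; proper classes of V are predicates at level suc ℓ.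

data V (ℓ : Level) : Set (suc ℓ) where
  sup : (I : Set ℓ) → (I → V ℓ) → V ℓ

module _ {ℓ : Level} where

  infix 4 _≈ᵛ_ _∈ᵛ_

  _≈ᵛ_ : V ℓ → V ℓ → Set ℓ
  sup I f ≈ᵛ sup J g = (∀ i → ∃[ j ] f i ≈ᵛ g j) × (∀ j → ∃[ i ] f i ≈ᵛ g j)

  _∈ᵛ_ : V ℓ → V ℓ → Set ℓ
  x ∈ᵛ sup J g = ∃[ j ] x ≈ᵛ g j

  upair : V ℓ → V ℓ → V ℓ
  upair x y = sup (Lift ℓ Bool) (λ b → if lower b then x else y)

  -- Kuratowski pair.
  opair : V ℓ → V ℓ → V ℓ
  opair x y = upair (upair x x) (upair x y)

  Class : Set (suc (suc ℓ))
  Class = Pred (V ℓ) (suc ℓ)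

  -- The class P is a set, and that set belongs to the class M.
  infix 4 _∈ᶜ_
  _∈ᶜ_ : Class → Class → Set (suc ℓ)
  P ∈ᶜ M = ∃[ z ] z ∈ M × (∀ x → x ∈ᵛ z ⇔ x ∈ P)

  -- Collapse E a x: the Mostowski collapse of a, with respect to E, is x, i.e.
  -- x = { collapse of b ∣ b E a }.  It is a relation defined by recursion on
  -- x, so that no well-foundedness has to be known beforehand.
  Collapse : {X : Set (suc ℓ)} → Rel X ℓ → X → Class
  Collapse E a (sup I f) =
    (∀ b → E b a → ∃[ i ] Collapse E b (f i)) ×
    (∀ i → ∃[ b ] E b a × Collapse E b (f i))

  -- The transitive class isomorphic to the structure (X , E), if there is one.
  -- When E is a representation on representatives of the membership relation
  -- of an extensional quotient of X, equivalent representatives have the same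
  -- collapse, so the quotient itself need not be formed.
  TransitiveModel : {X : Set (suc ℓ)} → Rel X ℓ → Class
  TransitiveModel E x = ∃[ a ] Collapse E a x

-- Choice in V: every set of nonempty, pairwise disjoint sets has a transversal.
AxiomOfChoice : (ℓ : Level) → Set (suc ℓ)
AxiomOfChoice ℓ =
  (x : V ℓ) →
  (∀ y → y ∈ᵛ x → ∃[ z ] z ∈ᵛ y) →
  (∀ y y′ z → y ∈ᵛ x → y′ ∈ᵛ x → z ∈ᵛ y → z ∈ᵛ y′ → y ≈ᵛ y′) →
  ∃[ c ] (∀ y → y ∈ᵛ x →
    ∃[ z ] z ∈ᵛ y × z ∈ᵛ c × (∀ w → w ∈ᵛ y → w ∈ᵛ c → w ≈ᵛ z))

IsLub : ∀ {a r i} {A : Set a} → Rel A r → {I : Set i} → (I → A) → A → Set (a ⊔ r ⊔ i)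
IsLub _≤_ f x = (∀ i → f i ≤ x) × (∀ y → (∀ i → f i ≤ y) → x ≤ y)

-- A complete Boolean algebra that is an element of V: its elements are V-sets
-- via the injection code, and 𝔹 ∈ V is the set sup Carrier code.
record CompleteBooleanAlgebra (ℓ : Level) : Set (suc ℓ) where
  field
    booleanAlgebra : BooleanAlgebra ℓ ℓ ℓ

  open BooleanAlgebra booleanAlgebra public
    using (Carrier; _≈_; _≤_; _∨_; _∧_; ⊤; ⊥; _⇨_)
    renaming (¬_ to ∁_)

  field
    ⋁              : {I : Set ℓ} → (I → Carrier) → Carrier
    ⋁-isLub        : {I : Set ℓ} (f : I → Carrier) → IsLub _≤_ f (⋁ f)
    code           : Carrier → V ℓ
    code-cong      : ∀ {a b} → a ≈ b → code a ≈ᵛ code b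
    code-injective : ∀ {a b} → code a ≈ᵛ code b → a ≈ b

  ⋀ : {I : Set ℓ} → (I → Carrier) → Carrier
  ⋀ f = ∁ (⋁ (λ i → ∁ f i))

module _ {ℓ : Level} (𝔹 : CompleteBooleanAlgebra ℓ) where

  open CompleteBooleanAlgebra 𝔹

  record Ultrafilter : Set (suc ℓ) where
    field
      member   : Pred Carrier ℓ
      upward   : ∀ {a b} → a ≤ b → a ∈ member → b ∈ member
      ∧-closed : ∀ {a b} → a ∈ member → b ∈ member → (a ∧ b) ∈ member
      ⊤-member : ⊤ ∈ member
      proper   : ¬ (⊥ ∈ member)
      ultra    : ∀ a → a ∈ member ⊎ (∁ a) ∈ member

  -- 𝔹-names: name I σ b is the name { (σ i , b i) ∣ i ∈ I }.
  data Name : Set (suc ℓ) where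
    name : (I : Set ℓ) → (I → Name) → (I → Carrier) → Name

  ⟦_≐_⟧ : Name → Name → Carrier
  ⟦ name I σ b ≐ name J τ c ⟧ =
    ⋀ (λ i → b i ⇨ ⋁ (λ j → c j ∧ ⟦ σ i ≐ τ j ⟧)) ∧
    ⋀ (λ j → c j ⇨ ⋁ (λ i → b i ∧ ⟦ σ i ≐ τ j ⟧))

  ⟦_∈_⟧ : Name → Name → Carrier
  ⟦ σ ∈ name J τ c ⟧ = ⋁ (λ j → c j ∧ ⟦ σ ≐ τ j ⟧)

  check : V ℓ → Name
  check (sup I f) = name I (λ i → check (f i)) (λ _ → ⊤)

  Ġ : Name
  Ġ = name Carrier (check ∘ code) id

  upairᴺ : Name → Name → Name
  upairᴺ σ τ = name (Lift ℓ Bool) (λ b → if lower b then σ else τ) (λ _ → ⊤)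

  opairᴺ : Name → Name → Name
  opairᴺ σ τ = upairᴺ (upairᴺ σ σ) (upairᴺ σ τ)

  record IsAntichain (A : Pred Carrier ℓ) : Set ℓ where
    field
      respects     : A Respects _≈_
      nonzero      : ∀ {a} → a ∈ A → ¬ (a ≈ ⊥)
      incompatible : ∀ {a b} → a ∈ A → b ∈ A → ¬ (a ≈ b) → (a ∧ b) ≈ ⊥

  record MaximalAntichain : Set (suc ℓ) where
    field
      elements    : Pred Carrier ℓ
      isAntichain : IsAntichain elements
      maximal     : (A : Pred Carrier ℓ) → IsAntichain A → elements ⊆ A → A ⊆ elements

  open MaximalAntichain

  El : MaximalAntichain → Set ℓ
  El A = Σ[ a ∈ Carrier ] a ∈ elements A

  infix 4 _≤*_
  _≤*_ : MaximalAntichain → MaximalAntichain → Set ℓ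
  B ≤* A = ∀ {b} → b ∈ elements B → ∃[ a ] a ∈ elements A × b ≤ a

  asSet : MaximalAntichain → V ℓ
  asSet A = sup (El A) (code ∘ proj₁)

  -- Functions f : A → V.
  record Fun (A : MaximalAntichain) : Set (suc ℓ) where
    field
      apply : El A → V ℓ
      cong  : ∀ {a b} → proj₁ a ≈ proj₁ b → apply a ≈ᵛ apply b

  open Fun

  graph : {A : MaximalAntichain} → Fun A → V ℓ
  graph {A} f = sup (El A) (λ a → opair (code (proj₁ a)) (apply f a))

  module _ (U : Ultrafilter) where

    open Ultrafilter U

    infix 4 _E_

    -- Elements [ σ ]_U of V^𝔹/U are given by representatives σ; equality of
    -- classes is ⟦ σ ≐ τ ⟧ ∈ U, with which E and InV̌ are compatible.
    _E_ : Rel Name ℓ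
    σ E τ = ⟦ σ ∈ τ ⟧ ∈ member

    -- ⟦ σ ∈ V̌ ⟧ is a join indexed by the proper class V, hence not an instance
    -- of the operation ⋁; it is the least upper bound b of the class-sized family.
    InV̌ : Pred Name (suc ℓ)
    InV̌ σ = ∃[ b ] IsLub _≤_ (λ (x : V ℓ) → ⟦ σ ≐ check x ⟧) b × b ∈ member

    WellFoundedUltrapower : Set (suc ℓ)
    WellFoundedUltrapower =
      WellFounded {A = Σ Name InV̌} (λ σ τ → proj₁ σ E proj₁ τ)

    V^𝔹/U : Class
    V^𝔹/U = TransitiveModel _E_

    -- X ∈ U_A, for X ⊆ A.
    InU : (A : MaximalAntichain) → Pred (Pred (El A) ℓ) ℓ
    InU A X = ⋁ {I = Σ (El A) X} (proj₁ ∘ proj₁) ∈ member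

    -- [ f ] ∈ [ g ] in the ultrapower of V by U_A.
    Eᵁ : (A : MaximalAntichain) → Rel (Fun A) ℓ
    Eᵁ A f g = InU A (λ a → apply f a ∈ᵛ apply g a)

    M : MaximalAntichain → Class
    M A = TransitiveModel (Eᵁ A)

    -- [ β ]_U = b_A, the element of j(A) ∩ G.
    Is-b : MaximalAntichain → Pred Name ℓ
    Is-b A β = β E check (asSet A) × β E Ġ

    -- [ σ ]_U = j(f)(b_A), i.e. [ σ ]_U = π_{A,∞}([ f ]).
    Value : {A : MaximalAntichain} → Fun A → Pred Name (suc ℓ)
    Value {A} f σ = ∃[ β ] Is-b A β × opairᴺ β σ E check (graph f)

    -- G_A = π_{A,∞}⁻¹[G], as a class of elements of the transitive model M_A.
    G[_] : MaximalAntichain → Class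
    G[ A ] x = ∃[ f ] Collapse (Eᵁ A) f x × ∃[ σ ] Value f σ × σ E Ġ

    Simple : MaximalAntichain → Set (suc ℓ)
    Simple A = G[ A ] ∈ᶜ M A

    -- { j(A k) ∣ k ∈ K }, as a class of elements of the transitive model V^𝔹/U.
    j[_] : {K : Set ℓ} → (K → MaximalAntichain) → Class
    j[_] {K} 𝔄 x = ∃[ k ] Collapse _E_ (check (asSet (𝔄 k))) x

    record Skeleton : Set (suc ℓ) where
      field
        K        : Set ℓ
        𝔄        : K → MaximalAntichain
        directed : ∀ k l → ∃[ m ] 𝔄 m ≤* 𝔄 k × 𝔄 m ≤* 𝔄 l
        j[𝔄]∈    : j[ 𝔄 ] ∈ᶜ V^𝔹/U
        generate : ∀ σ → InV̌ σ ⇔ (∃[ k ] Σ[ f ∈ Fun (𝔄 k) ] Value f σ)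

    SimpleSkeleton : Set (suc ℓ)
    SimpleSkeleton = Σ[ S ∈ Skeleton ] (∀ k → Simple (Skeleton.𝔄 S k))

{-# OPTIONS --safe #-}
module Submission where

-- Let A be simple.  By Łoś, the name-valued functions on A, compared by the
-- ultrafilters g(a) that represent G_A in M_A, form a copy of V^𝔹/U inside M_A:
-- a function s stands for the mixture of the names s(a).  An ∈-induction in V
-- then shows that the collapse of this mixture is represented by the function
-- sending a to the collapse of s(a) with respect to g(a).  So V^𝔹/U ⊆ M_A.
--
-- Conversely, let x ∈ M_A for all A in the skeleton, say x = [ φ_A ], where all
-- elements of x are already values of names ν_i.  In V^𝔹/U, whether ν_i belongs
-- to x can be decided from b_A and j(φ_A), for any j(A) ∈ j[𝔄].  As j[𝔄] has a
-- name J, the name X with entries ν_i weighted by the Boolean value of "for all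
-- A ∈ J, ν_i belongs to x according to A" makes sense.  Its collapse is x: each
-- element of X is a mixture of the ν_i along an index in V̌_U, and this index is
-- of the form j(h)(b_A) for some A in the skeleton.

open import Defs
open import Axiom.ExcludedMiddle using (ExcludedMiddle)
open import Data.Bool using (Bool; true; false; T)
open import Data.Empty using (⊥-elim) renaming (⊥ to Empty)
open import Data.Product using (Σ; Σ-syntax; ∃; ∃-syntax; _×_; _,_; proj₁; proj₂)
open import Data.Sum using (_⊎_; inj₁; inj₂)
open import Data.Maybe.Base using (Maybe; just; nothing)
open import Function.Base using (_∘_; id)
open import Function.Bundles using (_⇔_; mk⇔; Equivalence)
open import Induction.WellFounded using (Acc; acc)
open import Level using (Level; suc; _⊔_; Lift; lift; lower)
open import Relation.Binary.Core using (Rel)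
open import Relation.Binary.Lattice.Bundles using (BooleanAlgebra)
open import Relation.Binary.PropositionalEquality using (_≡_; refl; sym; subst)
open import Relation.Nullary using (¬_; Dec; yes; no; does)
open import Relation.Nullary.Decidable using (True; toWitness; fromWitness)
open import Relation.Unary using (Pred; _∈_; _⊆_; _≐_; ⋂)

open Equivalence using (to; from)

-- Choice is available for sets in V, while antichains and names carry an equality of their own.
-- `em` alone gives witnesses, but a function on `El 𝔹 A` built from them may take different values
-- at equal antichain elements and then represents nothing in M_A. Choices of functions on an
-- antichain therefore pass through codes in V (`selector`). Mixing names needs more: a family of
-- Boolean values has to be made disjoint along a well-order, whence Zermelo's argument.
--
-- The other obstacle is that well-foundedness is given for the Boolean ultrapower of V only.
-- Neither V^𝔹/U nor the names modulo g(a) come with a rank. Inductions therefore run along the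
-- collapsed set in V, collapses are transported along bisimulations, and the existence of pointwise
-- collapses is itself a Łoś argument: uncollapsible members chosen for almost all a would mix to a
-- member that does collapse.

-- Equality, membership and pairs in V

module _ {ℓ : Level} where

  ≈ᵛ-refl : (x : V ℓ) → x ≈ᵛ x
  ≈ᵛ-refl (sup I f) = (λ i → i , ≈ᵛ-refl (f i)) , (λ i → i , ≈ᵛ-refl (f i))

  ≈ᵛ-sym : {x y : V ℓ} → x ≈ᵛ y → y ≈ᵛ x
  ≈ᵛ-sym {sup I f} {sup J g} (p , q) =
    (λ j → let i , e = q j in i , ≈ᵛ-sym e) , (λ i → let j , e = p i in j , ≈ᵛ-sym e)

  ≈ᵛ-trans : {x y z : V ℓ} → x ≈ᵛ y → y ≈ᵛ z → x ≈ᵛ z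
  ≈ᵛ-trans {sup I f} {sup J g} {sup K h} (p , q) (p′ , q′) =
    (λ i → let j , e = p i ; k , e′ = p′ j in k , ≈ᵛ-trans e e′) ,
    (λ k → let j , e′ = q′ k ; i , e = q j in i , ≈ᵛ-trans e e′)

  ∈ᵛ-respˡ : {x y z : V ℓ} → x ≈ᵛ y → x ∈ᵛ z → y ∈ᵛ z
  ∈ᵛ-respˡ {z = sup J g} e (j , p) = j , ≈ᵛ-trans (≈ᵛ-sym e) p

  ∈ᵛ-respʳ : {x y z : V ℓ} → y ≈ᵛ z → x ∈ᵛ y → x ∈ᵛ z
  ∈ᵛ-respʳ {y = sup J g} {sup K h} (p , q) (j , e) = let k , e′ = p j in k , ≈ᵛ-trans e e′

  ∈ᵛ-resp : {x x′ y y′ : V ℓ} → x ≈ᵛ x′ → y ≈ᵛ y′ → x ∈ᵛ y → x′ ∈ᵛ y′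
  ∈ᵛ-resp e e′ p = ∈ᵛ-respʳ e′ (∈ᵛ-respˡ e p)

  ≈ᵛ-ext : {x y : V ℓ} → (∀ z → z ∈ᵛ x → z ∈ᵛ y) → (∀ z → z ∈ᵛ y → z ∈ᵛ x) → x ≈ᵛ y
  ≈ᵛ-ext {sup I f} {sup J g} p q =
    (λ i → p (f i) (i , ≈ᵛ-refl (f i))) ,
    (λ j → let i , e = q (g j) (j , ≈ᵛ-refl (g j)) in i , ≈ᵛ-sym e)

  upair-elim : {x y z : V ℓ} → z ∈ᵛ upair x y → z ≈ᵛ x ⊎ z ≈ᵛ y
  upair-elim (lift true , e) = inj₁ e
  upair-elim (lift false , e) = inj₂ e

  upair-left : {x y : V ℓ} → x ∈ᵛ upair x y
  upair-left {x} = lift true , ≈ᵛ-refl x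

  upair-right : {x y : V ℓ} → y ∈ᵛ upair x y
  upair-right {y = y} = lift false , ≈ᵛ-refl y

  upair-≈ˡ : {x y x′ y′ : V ℓ} → upair x y ≈ᵛ upair x′ y′ → x ≈ᵛ x′ ⊎ x ≈ᵛ y′
  upair-≈ˡ e = upair-elim (∈ᵛ-respʳ e upair-left)

  upair-≈ʳ : {x y x′ y′ : V ℓ} → upair x y ≈ᵛ upair x′ y′ → y ≈ᵛ x′ ⊎ y ≈ᵛ y′
  upair-≈ʳ e = upair-elim (∈ᵛ-respʳ e upair-right)

  upair-≈-diag : {x y z : V ℓ} → upair x y ≈ᵛ upair z z → y ≈ᵛ z
  upair-≈-diag e with upair-≈ʳ e
  ... | inj₁ p = p
  ... | inj₂ p = p

  opair-injectiveˡ : {x y x′ y′ : V ℓ} → opair x y ≈ᵛ opair x′ y′ → x ≈ᵛ x′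
  opair-injectiveˡ e with upair-≈ˡ e
  ... | inj₁ p = upair-≈-diag p
  ... | inj₂ p = ≈ᵛ-sym (upair-≈-diag′ p)
    where
    upair-≈-diag′ : {x y z : V ℓ} → upair z z ≈ᵛ upair x y → x ≈ᵛ z
    upair-≈-diag′ e with upair-≈ˡ (≈ᵛ-sym e)
    ... | inj₁ p = p
    ... | inj₂ p = p

  opair-injectiveʳ : {x y x′ y′ : V ℓ} → opair x y ≈ᵛ opair x′ y′ → y ≈ᵛ y′
  opair-injectiveʳ {x} {y} {x′} {y′} e = by-cases (upair-≈ʳ e) (upair-≈ʳ (≈ᵛ-sym e))
    where
    x≈x′ : x ≈ᵛ x′
    x≈x′ = opair-injectiveˡ e

    via : y ≈ᵛ x′ → y′ ≈ᵛ x ⊎ y′ ≈ᵛ y → y ≈ᵛ y′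
    via p (inj₁ q) = ≈ᵛ-trans p (≈ᵛ-sym (≈ᵛ-trans q x≈x′))
    via p (inj₂ q) = ≈ᵛ-sym q

    by-cases : upair x y ≈ᵛ upair x′ x′ ⊎ upair x y ≈ᵛ upair x′ y′ →
               upair x′ y′ ≈ᵛ upair x x ⊎ upair x′ y′ ≈ᵛ upair x y → y ≈ᵛ y′
    by-cases (inj₁ p) (inj₁ q) = via (upair-≈-diag p) (inj₁ (upair-≈-diag q))
    by-cases (inj₁ p) (inj₂ q) = via (upair-≈-diag p) (upair-≈ʳ q)
    by-cases (inj₂ p) _ with upair-≈ʳ p
    ... | inj₂ q = q
    ... | inj₁ q = via q (upair-≈ʳ (≈ᵛ-sym p))

-- Excluded middle and choice respecting equality

module Classical {ℓ : Level} (em : ExcludedMiddle (suc ℓ)) where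

  em₀ : {P : Set ℓ} → Dec P
  em₀ {P} with em {Lift (suc ℓ) P}
  ... | yes (lift p) = yes p
  ... | no np = no (λ p → np (lift p))

  dne : {P : Set (suc ℓ)} → ¬ ¬ P → P
  dne {P} nnp with em {P}
  ... | yes p = p
  ... | no np = ⊥-elim (nnp np)

  dne₀ : {P : Set ℓ} → ¬ ¬ P → P
  dne₀ {P} nnp with em₀ {P}
  ... | yes p = p
  ... | no np = ⊥-elim (nnp np)

  -- Index types of joins, names and V-sets are small, while most conditions on names are large.
  -- Deciding them by `em` makes them small enough for comprehension.
  Shrink : Set (suc ℓ) → Set ℓ
  Shrink P = Lift ℓ (True (em {P}))

  shrink : {P : Set (suc ℓ)} → P → Shrink P
  shrink p = lift (fromWitness p)

  unshrink : {P : Set (suc ℓ)} → Shrink P → P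
  unshrink (lift t) = toWitness t

  module Choice (ac : AxiomOfChoice ℓ) where

    -- Choice functions supplied by em need not respect ≈ᵛ; composed with F
    -- they do.
    selector : {I : Set ℓ} (c d : I → V ℓ) →
      Σ[ F ∈ (I → I) ] (∀ i → c (F i) ≈ᵛ c i) × (∀ i j → c i ≈ᵛ c j → d (F i) ≈ᵛ d (F j))
    selector {I} c d = F , F-≈ , F-ext
      where
      -- Pairing with `c j` makes the fibres of different classes disjoint; the one pair that the
      -- transversal selects in a fibre then fixes the `d`-value for the whole class.
      fibre : I → V ℓ
      fibre i = sup (Σ[ j ∈ I ] c j ≈ᵛ c i) (λ (j , _) → opair (c j) (d j))

      fibre-mono : ∀ {i i′} → c i ≈ᵛ c i′ → ∀ z → z ∈ᵛ fibre i → z ∈ᵛ fibre i′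
      fibre-mono e z ((j , p) , q) = (j , ≈ᵛ-trans p e) , q

      fibre-cong : ∀ {i i′} → c i ≈ᵛ c i′ → fibre i ≈ᵛ fibre i′
      fibre-cong e = ≈ᵛ-ext (fibre-mono e) (fibre-mono (≈ᵛ-sym e))

      nonempty : ∀ y → y ∈ᵛ sup I fibre → ∃[ z ] z ∈ᵛ y
      nonempty y (i , e) = opair (c i) (d i) ,
        ∈ᵛ-respʳ (≈ᵛ-sym e) ((i , ≈ᵛ-refl _) , ≈ᵛ-refl _)

      disjoint : ∀ y y′ z → y ∈ᵛ sup I fibre → y′ ∈ᵛ sup I fibre → z ∈ᵛ y → z ∈ᵛ y′ → y ≈ᵛ y′
      disjoint y y′ z (i , e) (i′ , e′) p p′
        with ∈ᵛ-respʳ e p | ∈ᵛ-respʳ e′ p′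
      ... | (j , q) , r | (j′ , q′) , r′ =
        ≈ᵛ-trans e (≈ᵛ-trans (fibre-cong
          (≈ᵛ-trans (≈ᵛ-sym q) (≈ᵛ-trans (opair-injectiveˡ (≈ᵛ-trans (≈ᵛ-sym r) r′)) q′)))
          (≈ᵛ-sym e′))

      transversal = ac (sup I fibre) nonempty disjoint

      chosen : ∀ i → ∃[ z ] z ∈ᵛ fibre i × z ∈ᵛ proj₁ transversal ×
        (∀ w → w ∈ᵛ fibre i → w ∈ᵛ proj₁ transversal → w ≈ᵛ z)
      chosen i = proj₂ transversal (fibre i) (i , ≈ᵛ-refl _)

      F : I → I
      F i = proj₁ (proj₁ (proj₁ (proj₂ (chosen i))))

      F-≈ : ∀ i → c (F i) ≈ᵛ c i
      F-≈ i = proj₂ (proj₁ (proj₁ (proj₂ (chosen i))))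

      F-ext : ∀ i j → c i ≈ᵛ c j → d (F i) ≈ᵛ d (F j)
      F-ext i j e with chosen i | chosen j
      ... | z , (k , p) , z∈C , _ | z′ , (k′ , p′) , z′∈C , uniq =
        opair-injectiveʳ (≈ᵛ-trans (≈ᵛ-sym p)
          (≈ᵛ-trans (uniq z (fibre-mono e z (k , p)) z∈C) p′))

    -- The raw witness is taken at the representative `F i` and carried back to `i` by `R-ext`. The
    -- default `t₀` fills the places where `R i` is empty, so that the choice function is total even
    -- if witnesses exist only almost everywhere.
    choose : {I : Set ℓ} {t : Level} {T : Set t} (c : I → V ℓ) (d : T → V ℓ) (t₀ : T)
      (R : I → T → Set (suc ℓ)) →
      ((i : I) → Dec (Σ T (R i))) →
      (∀ {i j} → c i ≈ᵛ c j → ∀ {t} → R i t → R j t) →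
      Σ[ s ∈ (I → T) ] (∀ i j → c i ≈ᵛ c j → d (s i) ≈ᵛ d (s j)) × (∀ i → Σ T (R i) → R i (s i))
    choose {I} {T = T} c d t₀ R R? R-ext = s₀ ∘ F , F-ext , spec
      where
      pick : {i : I} → Dec (Σ T (R i)) → T
      pick (yes (t , _)) = t
      pick (no _) = t₀

      pick-spec : {i : I} (D : Dec (Σ T (R i))) → Σ T (R i) → R i (pick D)
      pick-spec (yes (_ , r)) _ = r
      pick-spec (no ¬r) r = ⊥-elim (¬r r)

      s₀ : I → T
      s₀ i = pick (R? i)

      sel = selector c (d ∘ s₀)
      F = proj₁ sel
      F-≈ = proj₁ (proj₂ sel)
      F-ext = proj₂ (proj₂ sel)

      spec : ∀ i → Σ T (R i) → R i (s₀ (F i))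
      spec i (t , r) = R-ext (F-≈ i) (pick-spec (R? (F i)) (t , R-ext (≈ᵛ-sym (F-≈ i)) r))

-- Forcing-style reasoning in a complete Boolean algebra

module BooleanAlgebraProperties {ℓ : Level} (em : ExcludedMiddle (suc ℓ)) (𝔹 : CompleteBooleanAlgebra ℓ) where

  open Classical em
  open CompleteBooleanAlgebra 𝔹 public
  open BooleanAlgebra booleanAlgebra public
    using (antisym; x∧y≤x; x∧y≤y; ∧-greatest; x≤x∨y; y≤x∨y; ∨-least; transpose-⇨; transpose-∧; maximum; minimum)
    renaming (refl to ≤-refl; trans to ≤-trans; reflexive to ≤-reflexive)
  open BooleanAlgebra.Eq booleanAlgebra public
    using () renaming (refl to ≈-refl; sym to ≈-sym; trans to ≈-trans)

  private variable
    r s p q z : Carrier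
    I : Set ℓ

  ∧-fst : r ≤ p ∧ q → r ≤ p
  ∧-fst h = ≤-trans h (x∧y≤x _ _)

  ∧-snd : r ≤ p ∧ q → r ≤ q
  ∧-snd h = ≤-trans h (x∧y≤y _ _)

  ∧-mono : p ≤ r → q ≤ s → p ∧ q ≤ r ∧ s
  ∧-mono h k = ∧-greatest (≤-trans (x∧y≤x _ _) h) (≤-trans (x∧y≤y _ _) k)

  -- With `r ≤ p` read as "r forces p", this and the rules below are natural deduction; the
  -- quantifier over `s ≤ r` supplies the extended context.
  ⇨-intro : (∀ {s} → s ≤ r → s ≤ p → s ≤ q) → r ≤ p ⇨ q
  ⇨-intro h = transpose-⇨ (h (x∧y≤x _ _) (x∧y≤y _ _))

  ⇨-elim : r ≤ p ⇨ q → r ≤ p → r ≤ q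
  ⇨-elim h k = ≤-trans (∧-greatest ≤-refl k) (transpose-∧ h)

  ⋁-upper : (f : I → Carrier) (i : I) → r ≤ f i → r ≤ ⋁ f
  ⋁-upper f i h = ≤-trans h (proj₁ (⋁-isLub f) i)

  ⋁-least : {f : I → Carrier} → (∀ i → f i ≤ z) → ⋁ f ≤ z
  ⋁-least {z = z} {f = f} h = proj₂ (⋁-isLub f) z h

  ∨-elim : r ≤ p ∨ q → (∀ {s} → s ≤ r → s ≤ p → s ≤ z) → (∀ {s} → s ≤ r → s ≤ q → s ≤ z) → r ≤ z
  ∨-elim h k l = ⇨-elim (≤-trans h (∨-least
    (⇨-intro (λ s≤p s≤r → k s≤r s≤p)) (⇨-intro (λ s≤q s≤r → l s≤r s≤q)))) ≤-refl

  ⋁-elim : {f : I → Carrier} → r ≤ ⋁ f → (∀ i {s} → s ≤ r → s ≤ f i → s ≤ z) → r ≤ z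
  ⋁-elim h k = ⇨-elim (≤-trans h (⋁-least (λ i → ⇨-intro (λ s≤f s≤r → k i s≤r s≤f)))) ≤-refl

  ⋁-map : {J : Set ℓ} {f : I → Carrier} {g : J → Carrier} →
    (∀ i → ∃[ j ] f i ≤ g j) → ⋁ f ≤ ⋁ g
  ⋁-map {g = g} h = ⋁-least (λ i → ⋁-upper g (proj₁ (h i)) (proj₂ (h i)))

  ∁-intro : (∀ {s} → s ≤ r → s ≤ p → s ≤ ⊥) → r ≤ ∁ p
  ∁-intro h = ≤-trans (⇨-intro h) (∨-least ≤-refl (minimum _))

  ∁-elim : r ≤ ∁ p → r ≤ p → r ≤ z
  ∁-elim h k = ≤-trans (⇨-elim (≤-trans h (x≤x∨y _ _)) k) (minimum _)

  ∁-cases : (p : Carrier) → (∀ {s} → s ≤ r → s ≤ p → s ≤ z) → (∀ {s} → s ≤ r → s ≤ ∁ p → s ≤ z) → r ≤ z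
  ∁-cases p k l = ∨-elim (≤-trans (transpose-⇨ (x∧y≤y _ _)) (⇨p∨p)) l k
    where
    ⇨p∨p : p ⇨ p ≤ ∁ p ∨ p
    -- The implication of the Boolean algebra is by definition `∁ p ∨ q`, so `p ⇨ p` already is the
    -- law of excluded middle.
    ⇨p∨p = ≤-refl

  ⋀-lower : {f : I → Carrier} (i : I) → r ≤ ⋀ f → r ≤ f i
  ⋀-lower {f = f} i h = ∁-cases (f i) (λ _ k → k)
    (λ s≤r k → ∁-elim (≤-trans s≤r h) (⋁-upper _ i k))

  ⋀-greatest : {f : I → Carrier} → (∀ i → r ≤ f i) → r ≤ ⋀ f
  ⋀-greatest {f = f} h = ∁-intro (λ s≤r k → ⋁-elim k (λ i t≤s l → ∁-elim l (≤-trans t≤s (≤-trans s≤r (h i)))))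

-- Names, Boolean values and mixing

module BooleanValued {ℓ : Level} (em : ExcludedMiddle (suc ℓ)) (𝔹 : CompleteBooleanAlgebra ℓ) where

  open Classical em
  open BooleanAlgebraProperties em 𝔹

  infix 10 _ˇ
  _ˇ : V ℓ → Name 𝔹
  x ˇ = check 𝔹 x

  private variable
    r s p q z : Carrier
    σ σ′ τ τ′ ρ ρ′ υ : Name 𝔹
    x y : V ℓ

  infix 9 _≗_ _ε_

  -- Left to unfold, ⟦_≐_⟧ would hide the names that it is applied to from unification.
  abstract

    _≗_ _ε_ : Name 𝔹 → Name 𝔹 → Carrier
    σ ≗ τ = ⟦_≐_⟧ 𝔹 σ τ
    σ ε τ = ⟦_∈_⟧ 𝔹 σ τ

    ≗-def : ∀ σ τ → σ ≗ τ ≡ ⟦_≐_⟧ 𝔹 σ τ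
    ≗-def σ τ = refl

    ε-def : ∀ σ τ → σ ε τ ≡ ⟦_∈_⟧ 𝔹 σ τ
    ε-def σ τ = refl

    ≗-intro′ : {I J : Set ℓ} {σ : I → Name 𝔹} {b : I → Carrier} {τ : J → Name 𝔹} {c : J → Carrier} →
      (∀ i {s} → s ≤ r → s ≤ b i → s ≤ ⋁ (λ j → c j ∧ σ i ≗ τ j)) →
      (∀ j {s} → s ≤ r → s ≤ c j → s ≤ ⋁ (λ i → b i ∧ σ i ≗ τ j)) →
      r ≤ name I σ b ≗ name J τ c
    ≗-intro′ h k = ∧-greatest (⋀-greatest (λ i → ⇨-intro (h i))) (⋀-greatest (λ j → ⇨-intro (k j)))

    ≗-forth : {I J : Set ℓ} {σ : I → Name 𝔹} {b : I → Carrier} {τ : J → Name 𝔹} {c : J → Carrier} →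
      r ≤ name I σ b ≗ name J τ c → ∀ i → r ≤ b i → r ≤ ⋁ (λ j → c j ∧ σ i ≗ τ j)
    ≗-forth h i k = ⇨-elim (⋀-lower i (∧-fst h)) k

    ≗-back : {I J : Set ℓ} {σ : I → Name 𝔹} {b : I → Carrier} {τ : J → Name 𝔹} {c : J → Carrier} →
      r ≤ name I σ b ≗ name J τ c → ∀ j → r ≤ c j → r ≤ ⋁ (λ i → b i ∧ σ i ≗ τ j)
    ≗-back h j k = ⇨-elim (⋀-lower j (∧-snd h)) k

    ε-intro : {J : Set ℓ} {τ : J → Name 𝔹} {c : J → Carrier} (j : J) →
      r ≤ c j → r ≤ σ ≗ τ j → r ≤ σ ε name J τ c
    ε-intro j h k = ⋁-upper _ j (∧-greatest h k)

    ε-elim : {J : Set ℓ} {τ : J → Name 𝔹} {c : J → Carrier} → r ≤ σ ε name J τ c →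
      (∀ j {s} → s ≤ r → s ≤ c j → s ≤ σ ≗ τ j → s ≤ z) → r ≤ z
    ε-elim h k = ⋁-elim h (λ j s≤r l → k j s≤r (∧-fst l) (∧-snd l))

  ≗-refl : ∀ σ → r ≤ σ ≗ σ
  ≗-refl (name I σ b) = ≗-intro′
    (λ i _ h → ⋁-upper _ i (∧-greatest h (≗-refl (σ i))))
    (λ i _ h → ⋁-upper _ i (∧-greatest h (≗-refl (σ i))))

  ≗-sym : ∀ σ τ → r ≤ σ ≗ τ → r ≤ τ ≗ σ
  ≗-sym (name I σ b) (name J τ c) h = ≗-intro′
    (λ j s≤r k → ⋁-elim (≗-back (≤-trans s≤r h) j k) λ i t≤s l →
      ⋁-upper _ i (∧-greatest (∧-fst l) (≗-sym (σ i) (τ j) (∧-snd l))))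
    (λ i s≤r k → ⋁-elim (≗-forth (≤-trans s≤r h) i k) λ j t≤s l →
      ⋁-upper _ j (∧-greatest (∧-fst l) (≗-sym (σ i) (τ j) (∧-snd l))))

  ≗-trans : ∀ σ τ ρ → r ≤ σ ≗ τ → r ≤ τ ≗ ρ → r ≤ σ ≗ ρ
  ≗-trans (name I σ b) (name J τ c) (name K ρ d) h h′ = ≗-intro′
    (λ i s≤r k → ⋁-elim (≗-forth (≤-trans s≤r h) i k) λ j t≤s l →
      ⋁-elim (≗-forth (≤-trans t≤s (≤-trans s≤r h′)) j (∧-fst l)) λ k u≤t m →
      ⋁-upper _ k (∧-greatest (∧-fst m)
        (≗-trans (σ i) (τ j) (ρ k) (≤-trans u≤t (∧-snd l)) (∧-snd m))))
    (λ k s≤r l → ⋁-elim (≗-back (≤-trans s≤r h′) k l) λ j t≤s l →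
      ⋁-elim (≗-back (≤-trans t≤s (≤-trans s≤r h)) j (∧-fst l)) λ i u≤t m →
      ⋁-upper _ i (∧-greatest (∧-fst m)
        (≗-trans (σ i) (τ j) (ρ k) (∧-snd m) (≤-trans u≤t (∧-snd l)))))

  ε-respˡ : ∀ σ σ′ τ → r ≤ σ ≗ σ′ → r ≤ σ ε τ → r ≤ σ′ ε τ
  ε-respˡ σ σ′ (name J τ c) h k = ε-elim k λ j s≤r l m →
    ε-intro j l (≗-trans σ′ σ (τ j) (≗-sym σ σ′ (≤-trans s≤r h)) m)

  ε-respʳ : ∀ σ τ τ′ → r ≤ τ ≗ τ′ → r ≤ σ ε τ → r ≤ σ ε τ′
  ε-respʳ σ (name J τ c) (name K τ′ d) h k = ε-elim k λ j s≤r l m →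
    ⋁-elim (≗-forth (≤-trans s≤r h) j l) λ k t≤s n →
    ε-intro k (∧-fst n) (≗-trans σ (τ j) (τ′ k) (≤-trans t≤s m) (∧-snd n))

  ≗-intro : ∀ σ τ → (∀ ρ {s} → s ≤ r → s ≤ ρ ε σ → s ≤ ρ ε τ) →
    (∀ ρ {s} → s ≤ r → s ≤ ρ ε τ → s ≤ ρ ε σ) → r ≤ σ ≗ τ
  ≗-intro (name I σ b) (name J τ c) h k = ≗-intro′
    (λ i s≤r l → ε-elim (h (σ i) s≤r (ε-intro i l (≗-refl (σ i)))) λ j _ m n →
      ⋁-upper _ j (∧-greatest m n))
    (λ j s≤r l → ε-elim (k (τ j) s≤r (ε-intro j l (≗-refl (τ j)))) λ i _ m n →
      ⋁-upper _ i (∧-greatest m (≗-sym (τ j) (σ i) n)))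

  check-cong : ∀ x y → x ≈ᵛ y → r ≤ x ˇ ≗ y ˇ
  check-cong (sup I f) (sup J g) (p , q) = ≗-intro′
    (λ i _ _ → let j , e = p i in ⋁-upper _ j (∧-greatest (maximum _) (check-cong (f i) (g j) e)))
    (λ j _ _ → let i , e = q j in ⋁-upper _ i (∧-greatest (maximum _) (check-cong (f i) (g j) e)))

  check-≉ : ∀ x y → ¬ x ≈ᵛ y → r ≤ x ˇ ≗ y ˇ → r ≤ z
  check-≉ (sup I f) (sup J g) ne h
    with em₀ {∃[ i ] ∀ j → ¬ f i ≈ᵛ g j} | em₀ {∃[ j ] ∀ i → ¬ f i ≈ᵛ g j}
  ... | yes (i , n) | _ = ⋁-elim (≗-forth h i (maximum _)) λ j _ l → check-≉ (f i) (g j) (n j) (∧-snd l)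
  ... | no _ | yes (j , n) = ⋁-elim (≗-back h j (maximum _)) λ i _ l → check-≉ (f i) (g j) (n i) (∧-snd l)
  ... | no a | no b = ⊥-elim (ne
    ( (λ i → dne₀ (λ n → a (i , λ j e → n (j , e))))
    , (λ j → dne₀ (λ n → b (j , λ i e → n (i , e)))) ))

  -- Equality of check names is two-valued, so below a Boolean value it can be traded for true
  -- equality in V.
  check-≈ : ∀ x y → (x ≈ᵛ y → r ≤ z) → r ≤ x ˇ ≗ y ˇ → r ≤ z
  check-≈ x y h k with em₀ {x ≈ᵛ y}
  ... | yes e = h e
  ... | no ne = check-≉ x y ne k

  -- Common interface to pairs formed from names and checks of pairs formed in V. Membership in a
  -- checked graph compares one kind with the other, so Kuratowski's lemma is wanted for mixed
  -- pairs.
  record IsPair (ρ σ τ : Name 𝔹) : Set (suc ℓ) where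
    field
      left  : ⊤ ≤ σ ε ρ
      right : ⊤ ≤ τ ε ρ
      only  : ∀ υ → υ ε ρ ≤ υ ≗ σ ∨ υ ≗ τ

  open IsPair

  upairᴺ-isPair : ∀ σ τ → IsPair (upairᴺ 𝔹 σ τ) σ τ
  upairᴺ-isPair σ τ .left = ε-intro (lift true) ≤-refl (≗-refl σ)
  upairᴺ-isPair σ τ .right = ε-intro (lift false) ≤-refl (≗-refl τ)
  upairᴺ-isPair σ τ .only υ = ε-elim ≤-refl
    λ { (lift true) _ _ h → ≤-trans h (x≤x∨y _ _) ; (lift false) _ _ h → ≤-trans h (y≤x∨y _ _) }

  check-upair-isPair : ∀ x y → IsPair (upair x y ˇ) (x ˇ) (y ˇ)
  check-upair-isPair x y .left = ε-intro (lift true) ≤-refl (≗-refl (x ˇ))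
  check-upair-isPair x y .right = ε-intro (lift false) ≤-refl (≗-refl (y ˇ))
  check-upair-isPair x y .only υ = ε-elim ≤-refl
    λ { (lift true) _ _ h → ≤-trans h (x≤x∨y _ _) ; (lift false) _ _ h → ≤-trans h (y≤x∨y _ _) }

  IsPair-swap : IsPair ρ σ τ → IsPair ρ τ σ
  IsPair-swap p .left = p .right
  IsPair-swap p .right = p .left
  IsPair-swap p .only υ = ≤-trans (p .only υ) (∨-least (y≤x∨y _ _) (x≤x∨y _ _))

  IsPair-cong : IsPair ρ σ τ → IsPair ρ′ σ′ τ′ → r ≤ σ ≗ σ′ → r ≤ τ ≗ τ′ → r ≤ ρ ≗ ρ′
  IsPair-cong {ρ} {σ} {τ} {ρ′} {σ′} {τ′} p p′ h k = ≗-intro ρ ρ′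
    (λ υ s≤r l → ∨-elim (≤-trans l (p .only υ))
      (λ t≤s m → ε-respˡ σ′ υ ρ′ (≗-sym υ σ′ (≗-trans υ σ σ′ m (≤-trans t≤s (≤-trans s≤r h))))
        (≤-trans (maximum _) (p′ .left)))
      (λ t≤s m → ε-respˡ τ′ υ ρ′ (≗-sym υ τ′ (≗-trans υ τ τ′ m (≤-trans t≤s (≤-trans s≤r k))))
        (≤-trans (maximum _) (p′ .right))))
    (λ υ s≤r l → ∨-elim (≤-trans l (p′ .only υ))
      (λ t≤s m → ε-respˡ σ υ ρ (≗-trans σ σ′ υ (≤-trans t≤s (≤-trans s≤r h)) (≗-sym υ σ′ m))
        (≤-trans (maximum _) (p .left)))
      (λ t≤s m → ε-respˡ τ υ ρ (≗-trans τ τ′ υ (≤-trans t≤s (≤-trans s≤r k)) (≗-sym υ τ′ m))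
        (≤-trans (maximum _) (p .right))))

  IsPair-≗ˡ : IsPair ρ σ τ → IsPair ρ′ σ′ τ′ → r ≤ ρ ≗ ρ′ → r ≤ σ ≗ σ′ ∨ σ ≗ τ′
  IsPair-≗ˡ {ρ} {σ} {τ} {ρ′} p p′ h =
    ≤-trans (ε-respʳ σ ρ ρ′ h (≤-trans (maximum _) (p .left))) (p′ .only σ)

  IsPair-≗-diagˡ : IsPair ρ σ τ → IsPair ρ′ υ υ → r ≤ ρ ≗ ρ′ → r ≤ σ ≗ υ
  IsPair-≗-diagˡ p p′ h = ∨-elim (IsPair-≗ˡ p p′ h) (λ _ k → k) (λ _ k → k)

  IsPair-≗-diagʳ : IsPair ρ σ τ → IsPair ρ′ υ υ → r ≤ ρ ≗ ρ′ → r ≤ τ ≗ υ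
  IsPair-≗-diagʳ p p′ h = IsPair-≗-diagˡ (IsPair-swap p) p′ h

  record IsOrderedPair (π σ τ : Name 𝔹) : Set (suc ℓ) where
    field
      {singleton doubleton} : Name 𝔹
      isSingleton : IsPair singleton σ σ
      isDoubleton : IsPair doubleton σ τ
      isPair      : IsPair π singleton doubleton

  open IsOrderedPair

  IsOrderedPair-cong : IsOrderedPair ρ σ τ → IsOrderedPair ρ′ σ′ τ′ →
    r ≤ σ ≗ σ′ → r ≤ τ ≗ τ′ → r ≤ ρ ≗ ρ′
  IsOrderedPair-cong o o′ h k = IsPair-cong (o .isPair) (o′ .isPair)
    (IsPair-cong (o .isSingleton) (o′ .isSingleton) h h)
    (IsPair-cong (o .isDoubleton) (o′ .isDoubleton) h k)

  IsOrderedPair-injectiveˡ : IsOrderedPair ρ σ τ → IsOrderedPair ρ′ σ′ τ′ → r ≤ ρ ≗ ρ′ → r ≤ σ ≗ σ′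
  IsOrderedPair-injectiveˡ {σ = σ} {σ′ = σ′} o o′ h = ∨-elim (IsPair-≗ˡ (o .isPair) (o′ .isPair) h)
    (λ _ k → IsPair-≗-diagˡ (o .isSingleton) (o′ .isSingleton) k)
    (λ _ k → ≗-sym σ′ σ (IsPair-≗-diagˡ (o′ .isDoubleton) (o .isSingleton)
      (≗-sym (o .singleton) (o′ .doubleton) k)))

  IsOrderedPair-injectiveʳ : IsOrderedPair ρ σ τ → IsOrderedPair ρ′ σ′ τ′ → r ≤ ρ ≗ ρ′ → r ≤ τ ≗ τ′
  IsOrderedPair-injectiveʳ {ρ} {σ} {τ} {ρ′} {σ′} {τ′} o o′ h =
    ∨-elim (IsPair-≗ˡ (IsPair-swap (o .isPair)) (o′ .isPair) h)
      (λ s≤r k → via s≤r (IsPair-≗-diagʳ (o .isDoubleton) (o′ .isSingleton) k))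
      (λ s≤r k → ∨-elim (IsPair-≗ˡ (IsPair-swap (o .isDoubleton)) (o′ .isDoubleton) k)
        (λ t≤s → via (≤-trans t≤s s≤r)) (λ _ l → l))
    where
    σ≗σ′ = IsOrderedPair-injectiveˡ o o′ h

    via : s ≤ _ → s ≤ τ ≗ σ′ → s ≤ τ ≗ τ′
    via s≤r k = ∨-elim (IsPair-≗ˡ (IsPair-swap (o′ .isPair)) (o .isPair) (≤-trans s≤r (≗-sym ρ ρ′ h)))
      (λ t≤s l → back t≤s (IsPair-≗-diagʳ (o′ .isDoubleton) (o .isSingleton) l))
      (λ t≤s l → ∨-elim (IsPair-≗ˡ (IsPair-swap (o′ .isDoubleton)) (o .isDoubleton) l)
        (λ u≤t → back (≤-trans u≤t t≤s)) (λ _ m → ≗-sym τ′ τ m))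
      where
      back : ∀ {t} → t ≤ _ → t ≤ τ′ ≗ σ → t ≤ τ ≗ τ′
      back t≤s l = ≗-trans τ σ′ τ′ (≤-trans t≤s k)
        (≗-sym τ′ σ′ (≗-trans τ′ σ σ′ l (≤-trans t≤s (≤-trans s≤r σ≗σ′))))

  opairᴺ-isOrderedPair : ∀ σ τ → IsOrderedPair (opairᴺ 𝔹 σ τ) σ τ
  opairᴺ-isOrderedPair σ τ = record
    { isSingleton = upairᴺ-isPair σ σ
    ; isDoubleton = upairᴺ-isPair σ τ
    ; isPair = upairᴺ-isPair _ _
    }

  check-opair-isOrderedPair : ∀ x y → IsOrderedPair (opair x y ˇ) (x ˇ) (y ˇ)
  check-opair-isOrderedPair x y = record
    { isSingleton = check-upair-isPair x x
    ; isDoubleton = check-upair-isPair x y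
    ; isPair = check-upair-isPair _ _
    }

  -- Names with equal codes are equal with value `⊤`. The codes let choice in V act on names, and
  -- their checks let a name in V^𝔹 point at a name.
  codeᴺ : Name 𝔹 → V ℓ
  codeᴺ (name I σ b) = sup I (λ i → opair (codeᴺ (σ i)) (code (b i)))

  codeᴺ-≈ : ∀ σ τ → codeᴺ σ ≈ᵛ codeᴺ τ → r ≤ σ ≗ τ
  codeᴺ-≈ (name I σ b) (name J τ c) (p , q) = ≗-intro′
    (λ i _ h → let j , e = p i in ⋁-upper _ j (∧-greatest
      (≤-trans h (≤-reflexive (code-injective (opair-injectiveʳ e))))
      (codeᴺ-≈ (σ i) (τ j) (opair-injectiveˡ e))))
    (λ j _ h → let i , e = q j in ⋁-upper _ i (∧-greatest
      (≤-trans h (≤-reflexive (≈-sym (code-injective (opair-injectiveʳ e)))))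
      (codeᴺ-≈ (σ i) (τ j) (opair-injectiveˡ e))))

  dom : Name 𝔹 → Set ℓ
  dom (name I σ b) = I

  entry : (σ : Name 𝔹) → dom σ → Name 𝔹
  entry (name I σ b) = σ

  weight : (σ : Name 𝔹) → dom σ → Carrier
  weight (name I σ b) = b

  ε-entry : ∀ σ (i : dom σ) → r ≤ weight σ i → r ≤ ρ ≗ entry σ i → r ≤ ρ ε σ
  ε-entry (name I σ b) i h k = ε-intro i h k

  ε-cases : ∀ σ → r ≤ ρ ε σ → (∀ i {s} → s ≤ r → s ≤ weight σ i → s ≤ ρ ≗ entry σ i → s ≤ z) → r ≤ z
  ε-cases (name I σ b) h k = ε-elim h k

  mixture : {X : Set ℓ} → (X → Carrier) → (X → Name 𝔹) → Name 𝔹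
  mixture {X} d τ = name (Σ X (dom ∘ τ)) (λ (x , i) → entry (τ x) i) (λ (x , i) → d x ∧ weight (τ x) i)

  -- The mixing lemma with compatibility in place of disjoint weights: different indices may carry
  -- names with equal codes, and Zermelo's order does not separate those.
  mixture-≗ : {X : Set ℓ} (d : X → Carrier) (τ : X → Name 𝔹) → (∀ x y → d x ∧ d y ≤ τ x ≗ τ y) →
    ∀ x → d x ≤ mixture d τ ≗ τ x
  mixture-≗ d τ compatible x = ≗-intro (mixture d τ) (τ x)
    (λ ρ s≤d h → ε-elim h λ (y , i) t≤s k l → ε-respʳ ρ (τ y) (τ x)
      (≤-trans (∧-greatest (∧-fst k) (≤-trans t≤s s≤d)) (compatible y x))
      (ε-entry (τ y) i (∧-snd k) l))
    (λ ρ s≤d h → ε-cases (τ x) h λ i t≤s k l → ε-intro (x , i) (∧-greatest (≤-trans t≤s s≤d) k) l)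

  -- Zermelo's argument: a V-set t is read as the stage of a transfinite
  -- process that adds one new point of X (up to c) at each step.
  module Stages (ac : AxiomOfChoice ℓ) {X : Set ℓ} (c : X → V ℓ) where

    open Choice ac

    extension : (X → Bool) → V ℓ
    extension S = sup (Σ[ x ∈ X ] T (S x)) (c ∘ proj₁)

    -- `X → Bool` is a small type of all subsets of `X`, whereas `Pred X ℓ` lies one level higher;
    -- both `selector` and `last` need a small index.
    characteristic : Pred X ℓ → X → Bool
    characteristic P x = does (em₀ {P x})

    characteristic-to : ∀ {P : Pred X ℓ} {x} → T (characteristic P x) → P x
    characteristic-to {P} {x} t with em₀ {P x}
    ... | yes p = p

    characteristic-from : ∀ {P : Pred X ℓ} {x} → P x → T (characteristic P x)
    characteristic-from {P} {x} p with em₀ {P x}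
    ... | yes _ = _
    ... | no n = n p

    toSet : Pred X ℓ → V ℓ
    toSet P = extension (characteristic P)

    toSet-mono : {P Q : Pred X ℓ} → P ⊆ Q → ∀ z → z ∈ᵛ toSet P → z ∈ᵛ toSet Q
    toSet-mono {P} {Q} h z ((x , p) , e) = (x , characteristic-from {Q} (h (characteristic-to {P} p))) , e

    Missing : V ℓ → Set ℓ
    Missing y = ∃[ x ] ¬ c x ∈ᵛ y

    abstract

      selected : Σ[ F ∈ (Σ (X → Bool) (Missing ∘ extension) → Σ (X → Bool) (Missing ∘ extension)) ]
        (∀ i → extension (proj₁ (F i)) ≈ᵛ extension (proj₁ i)) ×
        (∀ i j → extension (proj₁ i) ≈ᵛ extension (proj₁ j) →
          c (proj₁ (proj₂ (F i))) ≈ᵛ c (proj₁ (proj₂ (F j))))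
      selected = selector (extension ∘ proj₁) (c ∘ proj₁ ∘ proj₂)

      next : (P : Pred X ℓ) → Missing (toSet P) → X
      next P m = proj₁ (proj₂ (proj₁ selected (characteristic P , m)))

      next-∉ : (P : Pred X ℓ) (m : Missing (toSet P)) → ¬ c (next P m) ∈ᵛ toSet P
      next-∉ P m h = proj₂ (proj₂ (proj₁ selected (characteristic P , m)))
        (∈ᵛ-respʳ (≈ᵛ-sym (proj₁ (proj₂ selected) (characteristic P , m))) h)

      next-cong : ∀ {P Q m n} → P ⊆ Q → Q ⊆ P → c (next P m) ≈ᵛ c (next Q n)
      next-cong {P} {Q} h k =
        proj₂ (proj₂ selected) _ _ (≈ᵛ-ext (toSet-mono {P} {Q} h) (toSet-mono {Q} {P} k))

    IsNext : Pred X ℓ → Pred X ℓ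
    IsNext P x = ∃[ m ] c x ≈ᵛ c (next P m)

    Succ : Pred X ℓ → Pred X ℓ
    Succ P x = P x ⊎ IsNext P x

    Succ-cong : {P Q : Pred X ℓ} → P ⊆ Q → Q ⊆ P → Succ P ⊆ Succ Q
    Succ-cong h k (inj₁ p) = inj₁ (h p)
    Succ-cong {P} {Q} h k (inj₂ ((x , x∉) , e)) =
      inj₂ ((x , λ x∈ → x∉ (toSet-mono {Q} {P} k (c x) x∈)) , ≈ᵛ-trans e (next-cong {P} {Q} h k))

    Stage : V ℓ → Pred X ℓ
    Stage (sup J f) x = ∃[ j ] Succ (Stage (f j)) x

    Stage-resp : ∀ t {x y} → c x ≈ᵛ c y → Stage t x → Stage t y
    Stage-resp (sup J f) e (j , inj₁ p) = j , inj₁ (Stage-resp (f j) e p)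
    Stage-resp (sup J f) e (j , inj₂ (m , e′)) = j , inj₂ (m , ≈ᵛ-trans (≈ᵛ-sym e) e′)

    toSet-Stage : ∀ t {x} → c x ∈ᵛ toSet (Stage t) → Stage t x
    toSet-Stage t ((y , p) , e) = Stage-resp t (≈ᵛ-sym e) (characteristic-to {Stage t} p)

    IsNext-∉ : ∀ t {x} → IsNext (Stage t) x → ¬ Stage t x
    IsNext-∉ t {x} (m , e) p = next-∉ (Stage t) m
      (∈ᵛ-respˡ e ((x , characteristic-from {Stage t} p) , ≈ᵛ-refl _))

    Comparable : V ℓ → V ℓ → Set ℓ
    Comparable s t = Stage s ⊆ Stage t ⊎ Succ (Stage t) ⊆ Stage s

    -- If some `f j` lies beyond `t`, so does the union; if some `f j` has the same stage as `t`,
    -- then the union contains its successor. Otherwise each successor is still inside `Stage t`.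
    -- The last case consumes both directions of the induction hypothesis.
    compare-sup : ∀ {J f} t → (∀ j → Comparable (f j) t × Comparable t (f j)) → Comparable (sup J f) t
    compare-sup {J} {f} t ih = by-cases em₀ em₀
      where
      below : ∀ j → ¬ (∃[ j ] Succ (Stage t) ⊆ Stage (f j)) →
        ¬ (∃[ j ] Stage t ⊆ Stage (f j) × Stage (f j) ⊆ Stage t) →
        Comparable (f j) t → Comparable t (f j) → Succ (Stage (f j)) ⊆ Stage t
      below j a b (inj₂ h) _ = ⊥-elim (a (j , h))
      below j a b (inj₁ h) (inj₁ k) = ⊥-elim (b (j , k , h))
      below j a b (inj₁ h) (inj₂ k) = k

      by-cases : Dec (∃[ j ] Succ (Stage t) ⊆ Stage (f j)) →
        Dec (∃[ j ] Stage t ⊆ Stage (f j) × Stage (f j) ⊆ Stage t) → Comparable (sup J f) t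
      by-cases (yes (j , h)) _ = inj₂ (λ p → j , inj₁ (h p))
      by-cases (no _) (yes (j , h , k)) = inj₂ (λ p → j , Succ-cong {Stage t} h k p)
      by-cases (no a) (no b) = inj₁ (λ (j , p) → below j a b (proj₁ (ih j)) (proj₂ (ih j)) p)

    compare : ∀ s t → Comparable s t × Comparable t s
    compare s@(sup J f) t@(sup L g) =
      compare-sup t (λ j → compare (f j) t) ,
      compare-sup s (λ l → let p , q = compare s (g l) in q , p)

    IsStage : (X → Bool) → Set (suc ℓ)
    IsStage S = ∃[ t ] (∀ x → Stage t x ⇔ T (S x))

    abstract

      stageOf : (Σ[ S ∈ (X → Bool) ] Shrink (IsStage S)) → V ℓ
      stageOf (_ , h) = proj₁ (unshrink h)

      stageOf-spec : ∀ i x → Stage (stageOf i) x ⇔ T (proj₁ i x)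
      stageOf-spec (_ , h) = proj₂ (unshrink h)

      index : V ℓ → Σ[ S ∈ (X → Bool) ] Shrink (IsStage S)
      index t = characteristic (Stage t) ,
        shrink (t , λ x → mk⇔ (characteristic-from {Stage t}) (characteristic-to {Stage t}))

      Stage-index : ∀ t x → Stage t x ⇔ Stage (stageOf (index t)) x
      Stage-index t x = mk⇔
        (λ p → stageOf-spec (index t) x .from (characteristic-from {Stage t} p))
        (λ p → characteristic-to {Stage t} (stageOf-spec (index t) x .to p))

    -- Stages are indexed by the proper class V, but only set many subsets of `X` occur; `last`
    -- collects one index for each.
    last : V ℓ
    last = sup _ stageOf

    Succ⊆last : ∀ t → Succ (Stage t) ⊆ Stage last
    Succ⊆last t p = index t ,
      Succ-cong {Stage t} (λ {x} → Stage-index t x .to) (λ {x} → Stage-index t x .from) p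

    -- The process is stationary at `last`: a missing point would produce a next point, which
    -- `Succ⊆last` puts into the very stage that it is new to.
    last-full : ∀ x → Stage last x
    last-full x = toSet-Stage last (dne₀ λ n →
      let isNext = (x , n) , ≈ᵛ-refl (c (next (Stage last) (x , n))) in
      IsNext-∉ last isNext (Succ⊆last last (inj₂ isNext)))

    entrance : ∀ t {x} → Stage t x → ∃[ s ] IsNext (Stage s) x
    entrance (sup J f) (j , inj₁ p) = entrance (f j) p
    entrance (sup J f) (j , inj₂ h) = f j , h

    abstract

      before : X → V ℓ
      before x = proj₁ (entrance last (last-full x))

      before-next : ∀ x → IsNext (Stage (before x)) x
      before-next x = proj₂ (entrance last (last-full x))

    module _ (e : X → Carrier) where

      disjointed : X → Carrier
      disjointed x = e x ∧ ∁ ⋁ {I = Σ X (Stage (before x))} (e ∘ proj₁)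

      disjointed-cover : ∀ t {x} → Stage t x → e x ≤ ⋁ disjointed
      disjointed-cover (sup J f) (j , inj₁ p) = disjointed-cover (f j) p
      -- `before x` need not be a subterm of `t`. It is compared with `f j`, where `x` is new as
      -- well: were `before x` to contain the successor stage, it would already contain `x`. The
      -- recursion thus proceeds on `f j`.
      disjointed-cover (sup J f) {x} (j , inj₂ h) = ∁-cases (⋁ {I = Σ X (Stage (before x))} (e ∘ proj₁))
        (λ _ k → ≤-trans k (⋁-least (λ (y , p) →
          disjointed-cover (f j) (before⊆ (proj₁ (compare (before x) (f j))) p))))
        (λ s≤e k → ⋁-upper disjointed x (∧-greatest s≤e k))
        where
        before⊆ : Comparable (before x) (f j) → Stage (before x) ⊆ Stage (f j)
        before⊆ (inj₁ k) = k
        before⊆ (inj₂ k) = ⊥-elim (IsNext-∉ (before x) (before-next x) (k (inj₂ h)))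

      disjointed-disjoint : ∀ x y → ¬ c x ≈ᵛ c y → r ≤ disjointed x → r ≤ disjointed y → r ≤ z
      disjointed-disjoint {r} {z} x y ne h k = by-cases (compare (before x) (before y))
        where
        by-cases : Comparable (before x) (before y) × Comparable (before y) (before x) → r ≤ z
        by-cases (inj₂ p , _) =
          ∁-elim (∧-snd h) (⋁-upper _ (y , p (inj₂ (before-next y))) (∧-fst k))
        by-cases (inj₁ _ , inj₂ q) =
          ∁-elim (∧-snd k) (⋁-upper _ (x , q (inj₂ (before-next x))) (∧-fst h))
        by-cases (inj₁ p , inj₁ q) = ⊥-elim (ne (≈ᵛ-trans (proj₂ (before-next x))
          (≈ᵛ-trans (next-cong {Stage (before x)} p q) (≈ᵛ-sym (proj₂ (before-next y))))))

  -- Each point keeps only the part of its weight not covered earlier. This loses nothing of the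
  -- join, and makes the names compatible for mixing.
  maximum-principle : AxiomOfChoice ℓ → {X : Set ℓ} (e : X → Carrier) (τ : X → Name 𝔹) →
    ∃[ ρ ] ⋁ e ≤ ⋁ (λ x → e x ∧ ρ ≗ τ x)
  maximum-principle ac e τ = mixture d τ , ⋁-least (λ x → ≤-trans (disjointed-cover e last (last-full x))
      (⋁-map (λ y → y , ∧-greatest (x∧y≤x _ _) (mixture-≗ d τ compatible y))))
    where
    open Stages ac (codeᴺ ∘ τ)
    d = disjointed e
    compatible : ∀ x y → d x ∧ d y ≤ τ x ≗ τ y
    compatible x y with em₀ {codeᴺ (τ x) ≈ᵛ codeᴺ (τ y)}
    ... | yes p = codeᴺ-≈ (τ x) (τ y) p
    ... | no n = disjointed-disjoint e x y n (x∧y≤x _ _) (x∧y≤y _ _)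

-- Mostowski collapse and bisimulation

module _ {ℓ : Level} {X : Set (suc ℓ)} (Q : Rel X ℓ) where

  Collapse-resp : ∀ {a} x y → x ≈ᵛ y → Collapse Q a x → Collapse Q a y
  Collapse-resp (sup I f) (sup J g) (p , q) (forth , back) =
    (λ b h → let i , k = forth b h ; j , e = p i in j , Collapse-resp (f i) (g j) e k) ,
    (λ j → let i , e = q j ; b , h , k = back i in b , h , Collapse-resp (f i) (g j) e k)

  Collapse-unique : ∀ {a} x y → Collapse Q a x → Collapse Q a y → x ≈ᵛ y
  Collapse-unique (sup I f) (sup J g) (forth , back) (forth′ , back′) =
    (λ i → let b , h , k = back i ; j , k′ = forth′ b h in j , Collapse-unique (f i) (g j) k k′) ,
    (λ j → let b , h , k′ = back′ j ; i , k = forth b h in i , Collapse-unique (f i) (g j) k k′)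

  Collapse-member : ∀ {a b} x → Collapse Q a x → Q b a → ∃[ y ] y ∈ᵛ x × Collapse Q b y
  Collapse-member {b = b} (sup I f) (forth , _) h =
    let i , k = forth b h in f i , (i , ≈ᵛ-refl (f i)) , k

  Collapse-preimage : ∀ {a} x {y} → Collapse Q a x → y ∈ᵛ x → ∃[ b ] Q b a × Collapse Q b y
  Collapse-preimage (sup I f) {y} (_ , back) (i , e) =
    let b , h , k = back i in b , h , Collapse-resp (f i) y (≈ᵛ-sym e) k

  Collapse-cong : ∀ {a b} x → (∀ c → Q c a → Q c b) → (∀ c → Q c b → Q c a) →
    Collapse Q a x → Collapse Q b x
  Collapse-cong (sup I f) h k (forth , back) =
    (λ c e → forth c (k c e)) , (λ i → let c , e , l = back i in c , h c e , l)

  -- The carrier is a large type, so a collapse is a V-set only if the predecessors, up to having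
  -- the same predecessors themselves, have a small indexing.
  SetLike : X → Set (suc ℓ)
  SetLike a = Σ[ J ∈ Set ℓ ] Σ[ r ∈ (J → X) ] (∀ j → Q (r j) a) ×
    (∀ b → Q b a → ∃[ j ] (∀ c → Q c b → Q c (r j)) × (∀ c → Q c (r j) → Q c b))

  Collapse-exists : ∀ {a} → SetLike a → (∀ b → Q b a → ∃[ x ] Collapse Q b x) → ∃[ x ] Collapse Q a x
  Collapse-exists (J , r , r∈ , covers) ih = sup J (λ j → proj₁ (ih (r j) (r∈ j))) ,
    (λ b e → let j , h , k = covers b e in
      j , Collapse-cong _ k h (proj₂ (ih (r j) (r∈ j)))) ,
    (λ j → r j , r∈ j , proj₂ (ih (r j) (r∈ j)))

  Collapse-injective : {t : Level} (_∼_ : X → X → Set t) →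
    (∀ a b → (∀ c → Q c a → Q c b) → (∀ c → Q c b → Q c a) → a ∼ b) →
    (∀ {a b c} → a ∼ b → Q a c → Q b c) →
    ∀ {a b} x → Collapse Q a x → Collapse Q b x → a ∼ b
  Collapse-injective _∼_ ext resp x@(sup I f) k l = ext _ _ (half k l) (half l k)
    where
    half : ∀ {a b} → Collapse Q a x → Collapse Q b x → ∀ c → Q c a → Q c b
    half (forth , _) (_ , back) c e =
      let i , m = forth c e ; d , e′ , n = back i in
      resp (Collapse-injective _∼_ ext resp (f i) n m) e′

Collapse-bisim : {ℓ t : Level} {X Y : Set (suc ℓ)} (Q : Rel X ℓ) (Q′ : Rel Y ℓ) (R : X → Y → Set t) →
  (∀ {a b a′} → R a b → Q a′ a → ∃[ b′ ] Q′ b′ b × R a′ b′) →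
  (∀ {a b b′} → R a b → Q′ b′ b → ∃[ a′ ] Q a′ a × R a′ b′) →
  ∀ x {a b} → R a b → Collapse Q a x → Collapse Q′ b x
Collapse-bisim Q Q′ R forth back (sup I f) r (h , k) =
  (λ b′ e → let a′ , e′ , r′ = back r e ; i , l = h a′ e′ in
    i , Collapse-bisim Q Q′ R forth back (f i) r′ l) ,
  (λ i → let a′ , e′ , l = k i ; b′ , e , r′ = forth r e′ in
    b′ , e , Collapse-bisim Q Q′ R forth back (f i) r′ l)

-- The ultrafilter along a maximal antichain

module Antichains {ℓ : Level} (em : ExcludedMiddle (suc ℓ))
  (𝔹 : CompleteBooleanAlgebra ℓ) (U : Ultrafilter 𝔹) where

  open Classical em
  open BooleanAlgebraProperties em 𝔹
  open Ultrafilter U public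

  private variable
    r s p q z : Carrier
    x y : Level

  member-∁ : member (∁ p) → ¬ member p
  member-∁ {p} h k = proper (upward (∁-elim (x∧y≤x _ _) (x∧y≤y (∁ p) p)) (∧-closed h k))

  not-member : ¬ member p → member (∁ p)
  not-member {p} n with ultra p
  ... | inj₁ h = ⊥-elim (n h)
  ... | inj₂ h = h

  member-dne : ¬ member (∁ p) → member p
  member-dne {p} n with ultra p
  ... | inj₁ h = h
  ... | inj₂ h = ⊥-elim (n h)

  member-∧ : (∀ {r} → r ≤ p → r ≤ q → r ≤ z) → member p → member q → member z
  member-∧ h k l = upward (h (x∧y≤x _ _) (x∧y≤y _ _)) (∧-closed k l)

  module Along (A : MaximalAntichain 𝔹) where

    open MaximalAntichain A
    open IsAntichain isAntichain

    infix 4 _~_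
    _~_ : El 𝔹 A → El 𝔹 A → Set ℓ
    a ~ b = proj₁ a ≈ proj₁ b

    meet-cases : {a b : El 𝔹 A} → r ≤ proj₁ a → r ≤ proj₁ b → (a ~ b → r ≤ z) → r ≤ z
    meet-cases {a = a , a∈} {b , b∈} h k l with em₀ {a ≈ b}
    ... | yes e = l e
    ... | no n = ≤-trans (∧-greatest h k) (≤-trans (≤-reflexive (incompatible a∈ b∈ n)) (minimum _))

    -- The complement of the join, if nonzero, could be adjoined to the antichain; by maximality it
    -- is then already a member, hence below the join.
    ⊤≤⋁ : ⊤ ≤ ⋁ {I = El 𝔹 A} proj₁
    ⊤≤⋁ = ∁-cases join (λ _ h → h) (λ _ h → ≤-trans h (outside em₀))
      where
      join = ⋁ {I = El 𝔹 A} proj₁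

      extended : Pred Carrier ℓ
      extended a = a ∈ elements ⊎ a ≈ ∁ join × ¬ ∁ join ≈ ⊥

      meet-join : ∀ {a b} → a ∈ elements → b ≈ ∁ join → r ≤ a → r ≤ b → r ≤ ⊥
      meet-join a∈ e h k = ∁-elim (≤-trans k (≤-reflexive e)) (⋁-upper _ (_ , a∈) h)

      extended-isAntichain : IsAntichain 𝔹 extended
      extended-isAntichain = record
        { respects = λ { e (inj₁ h) → inj₁ (respects e h) ; e (inj₂ (h , n)) → inj₂ (≈-trans (≈-sym e) h , n) }
        ; nonzero = λ { (inj₁ h) → nonzero h ; (inj₂ (h , n)) e → n (≈-trans (≈-sym h) e) }
        ; incompatible = λ
          { (inj₁ h) (inj₁ k) n → incompatible h k n
          ; (inj₁ h) (inj₂ (k , _)) n → antisym (meet-join h k (x∧y≤x _ _) (x∧y≤y _ _)) (minimum _)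
          ; (inj₂ (h , _)) (inj₁ k) n → antisym (meet-join k h (x∧y≤y _ _) (x∧y≤x _ _)) (minimum _)
          ; (inj₂ (h , _)) (inj₂ (k , _)) n → ⊥-elim (n (≈-trans h (≈-sym k)))
          }
        }

      outside : Dec (∁ join ≈ ⊥) → ∁ join ≤ join
      outside (yes e) = ≤-trans (≤-reflexive e) (minimum _)
      outside (no n) =
        ⋁-upper _ (∁ join , maximal extended extended-isAntichain inj₁ (inj₂ (≈-refl , n))) ≤-refl

    Extensional : (El 𝔹 A → Set x) → Set (ℓ ⊔ x)
    Extensional X = ∀ {a b} → a ~ b → X a → X b

    -- The set Y ∈ U_A is required to respect ≈, since El A may list an element
    -- of A many times.
    Almost : (El 𝔹 A → Set x) → Set (suc ℓ ⊔ x)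
    Almost X = Σ[ Y ∈ Pred (El 𝔹 A) ℓ ] Extensional Y × InU 𝔹 U A Y × (∀ {a} → Y a → X a)

    Almost-map : {X : El 𝔹 A → Set x} {X′ : El 𝔹 A → Set y} → (∀ {a} → X a → X′ a) → Almost X → Almost X′
    Almost-map h (Y , ext , k , l) = Y , ext , k , λ p → h (l p)

    Almost-zip : {z : Level} {X : El 𝔹 A → Set x} {X′ : El 𝔹 A → Set y} {X″ : El 𝔹 A → Set z} →
      (∀ {a} → X a → X′ a → X″ a) → Almost X → Almost X′ → Almost X″
    Almost-zip h (Y , ext , k , l) (Y′ , ext′ , k′ , l′) =
      (λ a → Y a × Y′ a) , (λ e (p , q) → ext e p , ext′ e q) ,
      member-∧ (λ u v → ⋁-elim u λ (a , p) s≤r m → ⋁-elim (≤-trans s≤r v) λ (b , q) t≤s n →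
        meet-cases {a = a} {b} (≤-trans t≤s m) n λ e → ⋁-upper _ (b , ext e p , q) n) k k′ ,
      (λ (p , q) → h (l p) (l′ q))

    Almost-InU : {X : Pred (El 𝔹 A) ℓ} → Almost X → InU 𝔹 U A X
    Almost-InU (Y , _ , h , k) = upward (⋁-map (λ (a , p) → (a , k p) , ≤-refl)) h

    InU-Almost : {X : Pred (El 𝔹 A) ℓ} → Extensional X → InU 𝔹 U A X → Almost X
    InU-Almost {X} ext h = X , ext , h , id

    ¬Almost-empty : ¬ Almost (λ _ → Empty)
    ¬Almost-empty (Y , _ , h , k) = proper (upward (⋁-least (λ (a , p) → ⊥-elim (k p))) h)

    -- The ultrafilter step of Łoś. It starts the arguments by contradiction below: counterexamples
    -- are chosen for almost all `a` and assembled into one element of the ultrapower or one name.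
    Almost-dne : {X : El 𝔹 A → Set (suc ℓ)} → Extensional X → ¬ Almost (λ a → ¬ X a) → Almost X
    Almost-dne {X} ext n = Y , ext-Y ,
      member-dne (λ h → n (complement , ext-∁ , upward below h , λ p q → p (shrink q))) , unshrink
      where
      Y complement : Pred (El 𝔹 A) ℓ
      Y a = Shrink (X a)
      complement a = ¬ Y a

      ext-Y : Extensional Y
      ext-Y e p = shrink (ext e (unshrink p))

      ext-∁ : Extensional complement
      ext-∁ e p q = p (ext-Y (≈-sym e) q)

      below : ∁ (⋁ {I = Σ (El 𝔹 A) Y} (proj₁ ∘ proj₁)) ≤ ⋁ {I = Σ (El 𝔹 A) complement} (proj₁ ∘ proj₁)
      below = ⋁-elim (≤-trans (maximum _) ⊤≤⋁) λ a s≤r k → by-cases a s≤r k em₀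
        where
        by-cases : ∀ a {s} → s ≤ _ → s ≤ proj₁ a → Dec (Y a) → s ≤ _
        by-cases a s≤r k (yes p) = ∁-elim s≤r (⋁-upper _ (a , p) k)
        by-cases a s≤r k (no p) = ⋁-upper _ (a , p) k

    -- If b respects ≈, this says that the class of b belongs to G_A.
    Glued : (El 𝔹 A → Carrier) → Set ℓ
    Glued b = member (⋁ (λ a → proj₁ a ∧ b a))

    Extensional₀ : (El 𝔹 A → Carrier) → Set ℓ
    Extensional₀ b = ∀ {a a′} → a ~ a′ → b a ≤ b a′

    Glued-map : {b b′ : El 𝔹 A → Carrier} → (∀ a {r} → r ≤ proj₁ a → r ≤ b a → r ≤ b′ a) → Glued b → Glued b′
    Glued-map h = upward (⋁-map (λ a → a , ∧-greatest (x∧y≤x _ _) (h a (x∧y≤x _ _) (x∧y≤y _ _))))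

    Glued-zip : {b b′ b″ : El 𝔹 A → Carrier} → Extensional₀ b′ →
      (∀ a {r} → r ≤ b a → r ≤ b′ a → r ≤ b″ a) → Glued b → Glued b′ → Glued b″
    Glued-zip ext h = member-∧ (λ u v → ⋁-elim u λ a s≤r m → ⋁-elim (≤-trans s≤r v) λ a′ t≤s n →
      let m = ≤-trans t≤s m in
      meet-cases {a = a} {a′} (∧-fst m) (∧-fst n) λ e →
        ⋁-upper _ a (∧-greatest (∧-fst m) (h a (∧-snd m) (≤-trans (∧-snd n) (ext (≈-sym e))))))

    Glued-all : {b : El 𝔹 A → Carrier} → (∀ a → proj₁ a ≤ b a) → Glued b
    Glued-all h = upward (≤-trans ⊤≤⋁ (⋁-map (λ a → a , ∧-greatest ≤-refl (h a)))) ⊤-member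

    Glued-const : member p → Glued (λ _ → p)
    Glued-const h = upward (⋁-elim (≤-trans (maximum _) ⊤≤⋁) λ a s≤p k → ⋁-upper _ a (∧-greatest k s≤p)) h

    Glued-Almost : {b b′ : El 𝔹 A → Carrier} {X : El 𝔹 A → Set x} →
      (∀ a {r} → X a → r ≤ b a → r ≤ b′ a) → Glued b → Almost X → Glued b′
    Glued-Almost h k (Y , ext , l , m) = member-∧ (λ u v → ⋁-elim u λ a s≤r n →
      ⋁-elim (≤-trans s≤r v) λ (a′ , p) t≤s o → let n = ≤-trans t≤s n in
      meet-cases {a = a} {a′} (∧-fst n) o λ e →
        ⋁-upper _ a (∧-greatest (∧-fst n) (h a (m (ext (≈-sym e) p)) (∧-snd n)))) k l

    Almost-Glued : {b : El 𝔹 A → Carrier} {X : El 𝔹 A → Set (suc ℓ)} → Extensional X →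
      (∀ a {r} → ¬ X a → r ≤ proj₁ a → r ≤ b a → r ≤ ⊥) → Glued b → Almost X
    Almost-Glued {X = X} ext h k =
      (λ a → Shrink (X a)) , (λ e p → shrink (ext e (unshrink p))) ,
      upward (⋁-least (λ a → by-cases a em₀)) k , unshrink
      where
      by-cases : ∀ a → Dec (Shrink (X a)) → _
      by-cases a (yes p) = ⋁-upper _ (a , p) (x∧y≤x _ _)
      by-cases a (no n) = ≤-trans (h a (λ p → n (shrink p)) (x∧y≤x _ _) (x∧y≤y _ _)) (minimum _)

-- Names modulo a filter

module Structures {ℓ : Level} (em : ExcludedMiddle (suc ℓ)) (ac : AxiomOfChoice ℓ)
  (𝔹 : CompleteBooleanAlgebra ℓ) (U : Ultrafilter 𝔹) where

  open Classical em
  open Choice ac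
  open BooleanAlgebraProperties em 𝔹
  open BooleanValued em 𝔹
  open Antichains em 𝔹 U

  private variable
    r s p q z : Carrier
    σ τ ρ ρ′ : Name 𝔹

  IsFilter : Pred Carrier ℓ → Set ℓ
  IsFilter P = ∀ {a b c} → P a → P b → a ∧ b ≤ c → P c

  member-isFilter : IsFilter member
  member-isFilter h k l = upward l (∧-closed h k)

  -- `P` will be `U`, or a value g(a) of the function representing G_A.
  E[_] : Pred Carrier ℓ → Rel (Name 𝔹) ℓ
  E[ P ] σ τ = P (⟦_∈_⟧ 𝔹 σ τ)

  module _ (P : Pred Carrier ℓ) where

    E-to : ∀ σ τ → E[ P ] σ τ → P (σ ε τ)
    E-to σ τ = subst P (sym (ε-def σ τ))

    E-from : ∀ σ τ → P (σ ε τ) → E[ P ] σ τ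
    E-from σ τ = subst P (ε-def σ τ)

    module _ (isFilter : IsFilter P) where

      filter-upward : p ≤ q → P p → P q
      filter-upward h k = isFilter k k (≤-trans (x∧y≤x _ _) h)

      filter-∧ : (∀ {r} → r ≤ p → r ≤ q → r ≤ z) → P p → P q → P z
      filter-∧ h k l = isFilter k l (h (x∧y≤x _ _) (x∧y≤y _ _))

      E-respʳ : ∀ τ → P (ρ ≗ σ) → E[ P ] τ ρ → E[ P ] τ σ
      E-respʳ {ρ} {σ} τ h k = E-from τ σ (filter-∧ (λ u v → ε-respʳ τ ρ σ u v) h (E-to τ ρ k))

      E-respˡ : ∀ τ → P (ρ ≗ σ) → E[ P ] ρ τ → E[ P ] σ τ
      E-respˡ {ρ} {σ} τ h k = E-from σ τ (filter-∧ (λ u v → ε-respˡ ρ σ τ u v) h (E-to ρ τ k))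

      filter-≗-sym : ∀ σ τ → P (σ ≗ τ) → P (τ ≗ σ)
      filter-≗-sym σ τ = filter-upward (≗-sym σ τ ≤-refl)

      -- Modulo P, an element ρ of σ is determined by its Boolean values
      -- of equality with the entries of σ.
      E-setLike : ∀ σ → SetLike E[ P ] σ
      E-setLike σ = Σ (dom σ → Carrier) (λ q → Shrink (Profile q)) , (λ (_ , h) → proj₁ (unshrink h)) ,
        (λ (_ , h) → proj₁ (proj₂ (unshrink h))) , covers
        where
        Profile : (dom σ → Carrier) → Set (suc ℓ)
        Profile q = ∃[ ρ ] E[ P ] ρ σ × (∀ i → q i ≈ weight σ i ∧ ρ ≗ entry σ i)

        agree : ∀ ρ {q} (h : Profile q) → (∀ i → q i ≈ weight σ i ∧ ρ ≗ entry σ i) →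
          E[ P ] ρ σ → P (ρ ≗ proj₁ h)
        agree ρ (ρ′ , _ , e′) e k = filter-upward (ε-cases σ ≤-refl λ i _ l m →
          ≗-trans ρ (entry σ i) ρ′ m (≗-sym ρ′ (entry σ i) (∧-snd
            (≤-trans (∧-greatest l m) (≤-reflexive (≈-trans (≈-sym (e i)) (e′ i))))))) (E-to ρ σ k)

        covers : ∀ ρ → E[ P ] ρ σ → ∃[ j ] _
        covers ρ k = (profile , h) , (λ τ → E-respʳ τ ρ≗) , (λ τ → E-respʳ τ (filter-≗-sym _ _ ρ≗))
          where
          profile : dom σ → Carrier
          profile i = weight σ i ∧ ρ ≗ entry σ i
          h : Shrink (Profile profile)
          h = shrink (ρ , k , λ i → ≈-refl)
          ρ≗ = agree ρ (unshrink h) (λ i → ≈-refl) k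

  infix 4 _E′_
  _E′_ : Rel (Name 𝔹) ℓ
  _E′_ = _E_ 𝔹 U

  E′-to : ∀ σ τ → σ E′ τ → member (σ ε τ)
  E′-to = E-to member

  E′-from : ∀ σ τ → member (σ ε τ) → σ E′ τ
  E′-from = E-from member

  glue : {X : Set ℓ} (e : X → Carrier) (τ : X → Name 𝔹) → member (⋁ e) →
    ∃[ ρ ] member (⋁ (λ x → e x ∧ ρ ≗ τ x))
  glue e τ h = let ρ , k = maximum-principle ac e τ in ρ , upward k h

  -- `gap σ τ` is the Boolean value of "some entry of `σ` is not in `τ`". If it were in `U`, gluing
  -- those entries would give a single `ρ` that separates the two classes.
  E′-extensional : ∀ σ τ → (∀ ρ → ρ E′ σ → ρ E′ τ) → (∀ ρ → ρ E′ τ → ρ E′ σ) → member (σ ≗ τ)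
  E′-extensional σ τ h k = member-∧ (λ u v → ≗-intro σ τ (half u) (half v))
    (not-member (no-gap σ τ h)) (not-member (no-gap τ σ k))
    where
    gap : Name 𝔹 → Name 𝔹 → Carrier
    gap σ τ = ⋁ (λ i → weight σ i ∧ ∁ (entry σ i ε τ))

    no-gap : ∀ σ τ → (∀ ρ → ρ E′ σ → ρ E′ τ) → ¬ member (gap σ τ)
    no-gap σ τ h k = let ρ , l = glue _ (entry σ) k in
      member-∁ (upward (⋁-least λ i → ∁-intro λ s≤ m → ∁-elim (∧-snd (∧-fst s≤))
          (ε-respˡ ρ (entry σ i) τ (∧-snd s≤) m)) l)
        (E′-to ρ τ (h ρ (E′-from ρ σ (upward (⋁-least λ i →
          ε-entry σ i (∧-fst (x∧y≤x _ _)) (x∧y≤y _ _)) l))))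

    half : ∀ {σ τ r} → r ≤ ∁ (gap σ τ) → ∀ ρ {s} → s ≤ r → s ≤ ρ ε σ → s ≤ ρ ε τ
    half {σ} {τ} h ρ s≤r k = ε-cases σ k λ i t≤s l m → ∁-cases (entry σ i ε τ)
      (λ u≤t n → ε-respˡ (entry σ i) ρ τ (≗-sym ρ (entry σ i) (≤-trans u≤t m)) n)
      (λ u≤t n → ∁-elim (≤-trans u≤t (≤-trans t≤s (≤-trans s≤r h)))
        (⋁-upper _ i (∧-greatest (≤-trans u≤t l) n)))

  E′-Collapse-injective : ∀ x → Collapse _E′_ σ x → Collapse _E′_ τ x → member (σ ≗ τ)
  E′-Collapse-injective = Collapse-injective _E′_ (λ σ τ → member (σ ≗ τ)) E′-extensional
    (λ {_} {_} {τ} → E-respˡ member member-isFilter τ)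

  -- The join over the class V, made small by indexing it with the Boolean values that actually
  -- occur.
  inV : Name 𝔹 → Carrier
  inV σ = ⋁ {I = Σ Carrier λ b → Shrink (∃[ x ] σ ≗ x ˇ ≈ b)} proj₁

  inV-upper : ∀ x → r ≤ σ ≗ x ˇ → r ≤ inV σ
  inV-upper {σ = σ} x h = ⋁-upper _ (σ ≗ x ˇ , shrink (x , ≈-refl)) h

  inV-elim : r ≤ inV σ → (∀ x {s} → s ≤ r → s ≤ σ ≗ x ˇ → s ≤ z) → r ≤ z
  inV-elim h k = ⋁-elim h λ (b , e) s≤r l → let x , e = unshrink e in
    k x s≤r (≤-trans l (≤-reflexive (≈-sym e)))

  InV̌-from : ∀ σ → member (inV σ) → InV̌ 𝔹 U σ
  InV̌-from σ h = inV σ ,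
    ((λ x → inV-upper x (≤-reflexive (unfold x))) ,
     (λ y k → inV-elim {σ = σ} ≤-refl λ x _ l →
       ≤-trans l (≤-trans (≤-reflexive (≈-sym (unfold x))) (k x)))) , h
    where
    unfold : ∀ x → ⟦_≐_⟧ 𝔹 σ (x ˇ) ≈ σ ≗ x ˇ
    unfold x = subst (λ b → b ≈ σ ≗ x ˇ) (≗-def σ (x ˇ)) ≈-refl

  InV̌-to : ∀ σ → InV̌ 𝔹 U σ → member (inV σ)
  InV̌-to σ (b , (_ , least) , h) = upward (least (inV σ) λ x →
    subst (_≤ inV σ) (≗-def σ (x ˇ)) (inV-upper x ≤-refl)) h

  check-InV̌ : ∀ x → InV̌ 𝔹 U (x ˇ)
  check-InV̌ x = InV̌-from (x ˇ) (upward (inV-upper x (≗-refl (x ˇ))) ⊤-member)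

  InV̌-transitive : ∀ σ τ → σ E′ τ → InV̌ 𝔹 U τ → InV̌ 𝔹 U σ
  InV̌-transitive σ τ h k = InV̌-from σ (member-∧ (λ u v → inV-elim v λ x s≤r l →
      below x (ε-respʳ σ τ (x ˇ) l (≤-trans s≤r u)))
      (E′-to σ τ h) (InV̌-to τ k))
    where
    below : ∀ x → s ≤ σ ε x ˇ → s ≤ inV σ
    below (sup I f) h = ε-elim h λ i _ _ k → inV-upper (f i) k

  module _ (wf : WellFoundedUltrapower 𝔹 U) where

    InV̌-Collapse : ∀ σ → InV̌ 𝔹 U σ → ∃[ x ] Collapse _E′_ σ x
    InV̌-Collapse σ h = go (wf (σ , h))
      where
      go : ∀ {σh} → Acc (λ σ τ → proj₁ σ E′ proj₁ τ) σh → ∃[ x ] Collapse _E′_ (proj₁ σh) x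
      go {σ , h} (acc rec) = Collapse-exists _E′_ (E-setLike member member-isFilter σ)
        (λ τ e → go (rec {τ , InV̌-transitive τ σ e h} e))

-- The ultrapower M_A and its map to the Boolean ultrapower

module Ultrapowers {ℓ : Level} (em : ExcludedMiddle (suc ℓ)) (ac : AxiomOfChoice ℓ)
  (𝔹 : CompleteBooleanAlgebra ℓ) (U : Ultrafilter 𝔹) (A : MaximalAntichain 𝔹) where

  open Classical em
  open Choice ac
  open BooleanAlgebraProperties em 𝔹
  open BooleanValued em 𝔹
  open Antichains em 𝔹 U
  open Structures em ac 𝔹 U
  open Along A

  private variable
    r s p q z : Carrier
    σ τ ρ : Name 𝔹

  record NameFun : Set (suc ℓ) where
    field
      apply : El 𝔹 A → Name 𝔹
      cong  : ∀ {a b} → a ~ b → ∀ {r} → r ≤ apply a ≗ apply b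

  open Fun renaming (apply to _⟨_⟩; cong to Fun-cong)
  open NameFun renaming (apply to _⟪_⟫; cong to NameFun-cong)

  constᴺ : Name 𝔹 → NameFun
  constᴺ σ = record { apply = λ _ → σ ; cong = λ _ → ≗-refl σ }

  checkFun : Fun 𝔹 A → NameFun
  checkFun f = record { apply = λ a → f ⟨ a ⟩ ˇ ; cong = λ e → check-cong _ _ (Fun-cong f e) }

  chooseFun : (R : El 𝔹 A → V ℓ → Set (suc ℓ)) → (∀ {v} → Extensional (λ a → R a v)) →
    Σ[ f ∈ Fun 𝔹 A ] (∀ a → ∃ (R a) → R a (f ⟨ a ⟩))
  chooseFun R ext with choose (code ∘ proj₁) id (sup Empty₀ (λ ())) R (λ _ → em) (λ e → ext (code-injective e))
    where Empty₀ = Lift ℓ Empty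
  ... | s , s-ext , spec = record { apply = s ; cong = λ {a} {b} e → s-ext a b (code-cong e) } , spec

  chooseName : (R : El 𝔹 A → Name 𝔹 → Set (suc ℓ)) → (∀ {τ} → Extensional (λ a → R a τ)) →
    Σ[ t ∈ NameFun ] (∀ a → ∃ (R a) → R a (t ⟪ a ⟫))
  chooseName R ext with choose (code ∘ proj₁) codeᴺ (Ġ 𝔹) R (λ _ → em) (λ e → ext (code-injective e))
  ... | t , t-ext , spec =
    record { apply = t ; cong = λ {a} {b} e → codeᴺ-≈ (t a) (t b) (t-ext a b (code-cong e)) } , spec

  -- [ s ] is a name in M_A, and σ is its image under (V^𝔹/G_A)^{M_A} ≅ V^𝔹/U.
  Represents : Name 𝔹 → NameFun → Set ℓ
  Represents σ s = Glued (λ a → σ ≗ s ⟪ a ⟫)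

  represented : (s : NameFun) → ∃[ σ ] Represents σ s
  represented s = glue proj₁ (s ⟪_⟫) (upward ⊤≤⋁ ⊤-member)

  Represents-const : ∀ σ → Represents σ (constᴺ σ)
  Represents-const σ = Glued-all (λ _ → ≗-refl σ)

  ≗-ext : ∀ σ (s : NameFun) → Extensional₀ (λ a → σ ≗ s ⟪ a ⟫)
  ≗-ext σ s {a} {b} e = ≗-trans σ (s ⟪ a ⟫) (s ⟪ b ⟫) ≤-refl (NameFun-cong s e)

  ε-ext : ∀ (s t : NameFun) → Extensional₀ (λ a → s ⟪ a ⟫ ε t ⟪ a ⟫)
  ε-ext s t {a} {b} e = ε-respˡ (s ⟪ a ⟫) (s ⟪ b ⟫) (t ⟪ b ⟫) (NameFun-cong s e)
    (ε-respʳ (s ⟪ a ⟫) (t ⟪ a ⟫) (t ⟪ b ⟫) (NameFun-cong t e) ≤-refl)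

  Glued-member : Glued (λ _ → p) → member p
  Glued-member = upward (⋁-least (λ _ → x∧y≤y _ _))

  E′-Glued : ∀ {s t} → Represents σ s → Represents τ t → σ E′ τ → Glued (λ a → s ⟪ a ⟫ ε t ⟪ a ⟫)
  E′-Glued {σ} {τ} {s} {t} h k l =
    Glued-zip (≗-ext τ t) (λ a u v → ε-respʳ (s ⟪ a ⟫) τ (t ⟪ a ⟫) v u)
      (Glued-zip (≗-ext σ s) (λ a u v → ε-respˡ σ (s ⟪ a ⟫) τ v u) (Glued-const (E′-to σ τ l)) h) k

  Glued-E′ : ∀ {s t} → Represents σ s → Represents τ t → Glued (λ a → s ⟪ a ⟫ ε t ⟪ a ⟫) → σ E′ τ
  Glued-E′ {σ} {τ} {s} {t} h k l = E′-from σ τ (Glued-member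
    (Glued-zip (≗-ext τ t) (λ a u v → ε-respʳ σ (t ⟪ a ⟫) τ (≗-sym τ (t ⟪ a ⟫) v) u)
      (Glued-zip (≗-ext σ s) (λ a u v → ε-respˡ (s ⟪ a ⟫) σ (t ⟪ a ⟫) (≗-sym σ (s ⟪ a ⟫) v) u) l h) k))

  Represents-InV̌ : ∀ f → Represents σ (checkFun f) → InV̌ 𝔹 U σ
  Represents-InV̌ {σ} f h = InV̌-from σ (Glued-member (Glued-map (λ a _ k → inV-upper (f ⟨ a ⟩) k) h))

  graph-entry : (f : Fun 𝔹 A) → El 𝔹 A → V ℓ
  graph-entry f a = opair (code (proj₁ a)) (f ⟨ a ⟩)

  -- Below `a` the name of b_A equals the check of `a`, so j(f)(b_A) equals the check of `f ⟨ a ⟩`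
  -- there.
  Value-Represents : (f : Fun 𝔹 A) → Value 𝔹 U f σ → Represents σ (checkFun f)
  Value-Represents {σ} f (β , (_ , β∈Ġ) , h) = member-∧
    (λ {r} u v → ε-elim u λ b s≤r l m → ε-elim (≤-trans s≤r v) λ a t≤s _ n →
      let x = code (proj₁ a)
          n₁ = IsOrderedPair-injectiveˡ (opairᴺ-isOrderedPair β σ) (check-opair-isOrderedPair x (f ⟨ a ⟩)) n
          n₂ = IsOrderedPair-injectiveʳ (opairᴺ-isOrderedPair β σ) (check-opair-isOrderedPair x (f ⟨ a ⟩)) n in
      check-≈ (code b) x
        (λ e → ⋁-upper _ a (∧-greatest
          (≤-trans (≤-trans t≤s l) (≤-reflexive (code-injective e))) n₂))
        (≗-trans (code b ˇ) β (x ˇ) (≗-sym β (code b ˇ) (≤-trans t≤s m)) n₁))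
    (E′-to β (Ġ 𝔹) β∈Ġ) (E′-to (opairᴺ 𝔹 β σ) (graph 𝔹 f ˇ) h)

  Represents-Value : (f : Fun 𝔹 A) → Represents σ (checkFun f) → Value 𝔹 U f σ
  Represents-Value {σ} f h = β ,
    ( E′-from β (asSet 𝔹 A ˇ) (upward (⋁-least λ a → ε-intro a (maximum _) (x∧y≤y _ _)) β-spec)
    , E′-from β (Ġ 𝔹) (upward (⋁-least λ a → ε-intro (proj₁ a) (x∧y≤x _ _) (x∧y≤y _ _)) β-spec) ) ,
    E′-from (opairᴺ 𝔹 β σ) (graph 𝔹 f ˇ) (upward (⋁-least λ a → ε-intro a (maximum _) (x∧y≤y _ _))
      (Glued-zip {b″ = λ a → opairᴺ 𝔹 β σ ≗ graph-entry f a ˇ} (≗-ext σ (checkFun f))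
        (λ a → IsOrderedPair-cong (opairᴺ-isOrderedPair β σ)
          (check-opair-isOrderedPair (code (proj₁ a)) (f ⟨ a ⟩)))
        β-spec h))
    where
    β = proj₁ (glue {El 𝔹 A} proj₁ (λ a → code (proj₁ a) ˇ) (upward ⊤≤⋁ ⊤-member))
    β-spec : Glued (λ a → β ≗ code (proj₁ a) ˇ)
    β-spec = proj₂ (glue {El 𝔹 A} proj₁ (λ a → code (proj₁ a) ˇ) (upward ⊤≤⋁ ⊤-member))

  check-∈ : ∀ x y → x ∈ᵛ y → r ≤ x ˇ ε y ˇ
  check-∈ x (sup J g) (j , e) = ε-intro j (maximum _) (check-cong x (g j) e)

  infix 4 _Eᴬ_ _≈ᴬ_
  _Eᴬ_ : Rel (Fun 𝔹 A) ℓ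
  _Eᴬ_ = Eᵁ 𝔹 U A

  _≈ᴬ_ : Fun 𝔹 A → Fun 𝔹 A → Set (suc ℓ)
  f ≈ᴬ g = Almost (λ a → f ⟨ a ⟩ ≈ᵛ g ⟨ a ⟩)

  ∈-ext : (f g : Fun 𝔹 A) → Extensional (λ a → f ⟨ a ⟩ ∈ᵛ g ⟨ a ⟩)
  ∈-ext f g {a} {b} e = ∈ᵛ-resp (Fun-cong f {a} {b} e) (Fun-cong g {a} {b} e)

  Eᴬ-to : ∀ f g → f Eᴬ g → Almost (λ a → f ⟨ a ⟩ ∈ᵛ g ⟨ a ⟩)
  Eᴬ-to f g = InU-Almost (λ {a} {b} → ∈-ext f g {a} {b})

  Eᴬ-from : ∀ f g → Almost (λ a → f ⟨ a ⟩ ∈ᵛ g ⟨ a ⟩) → f Eᴬ g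
  Eᴬ-from f g = Almost-InU

  Eᴬ-respˡ : ∀ f f′ g → f ≈ᴬ f′ → f Eᴬ g → f′ Eᴬ g
  Eᴬ-respˡ f f′ g h k = Eᴬ-from f′ g (Almost-zip ∈ᵛ-respˡ h (Eᴬ-to f g k))

  Eᴬ-respʳ : ∀ f g g′ → g ≈ᴬ g′ → f Eᴬ g → f Eᴬ g′
  Eᴬ-respʳ f g g′ h k = Eᴬ-from f g′ (Almost-zip ∈ᵛ-respʳ h (Eᴬ-to f g k))

  ≈ᴬ-sym : ∀ f g → f ≈ᴬ g → g ≈ᴬ f
  ≈ᴬ-sym f g = Almost-map ≈ᵛ-sym

  Eᴬ-E′ : ∀ f g → Represents σ (checkFun f) → Represents τ (checkFun g) → f Eᴬ g → σ E′ τ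
  Eᴬ-E′ f g h k l = Glued-E′ {s = checkFun f} {checkFun g} h k
    (Glued-Almost {b = λ _ → ⊤} (λ a e _ → check-∈ (f ⟨ a ⟩) (g ⟨ a ⟩) e) (Glued-const ⊤-member) (Eᴬ-to f g l))

  Eᴬ-extensional : ∀ f g → (∀ h → h Eᴬ f → h Eᴬ g) → (∀ h → h Eᴬ g → h Eᴬ f) → f ≈ᴬ g
  Eᴬ-extensional f g h k = Almost-zip (λ (lift u) (lift v) → ≈ᵛ-ext u v) (half f g h) (half g f k)
    where
    half : ∀ f g → (∀ h → h Eᴬ f → h Eᴬ g) →
      Almost (λ a → Lift (suc ℓ) (∀ z → z ∈ᵛ f ⟨ a ⟩ → z ∈ᵛ g ⟨ a ⟩))
    half f g h = Almost-dne
      (λ e (lift k) → lift (λ z m → ∈ᵛ-respʳ (Fun-cong g e) (k z (∈ᵛ-respʳ (≈ᵛ-sym (Fun-cong f e)) m))))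
      (λ gap → let w , spec = chooseFun (λ a z → Lift (suc ℓ) (z ∈ᵛ f ⟨ a ⟩ × ¬ z ∈ᵛ g ⟨ a ⟩))
                     (λ e (lift (m , n)) → lift (∈ᵛ-respʳ (Fun-cong f e) m ,
                       λ m′ → n (∈ᵛ-respʳ (≈ᵛ-sym (Fun-cong g e)) m′)))
                   wit = Almost-map (λ {a} n → lower (spec a (dne (λ none → n (lift (λ z m →
                     dne₀ (λ m′ → none (z , lift (m , m′))))))))) gap in
        ¬Almost-empty (Almost-zip (λ (_ , n) m → n m) wit
          (Eᴬ-to w g (h w (Eᴬ-from w f (Almost-map proj₁ wit))))))

  Eᴬ-Collapse-injective : ∀ f g x → Collapse _Eᴬ_ f x → Collapse _Eᴬ_ g x → f ≈ᴬ g
  Eᴬ-Collapse-injective f g = Collapse-injective _Eᴬ_ _≈ᴬ_ Eᴬ-extensional (λ {f} {g} {h} → Eᴬ-respˡ f g h)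

  index : V ℓ → Set ℓ
  index (sup I f) = I

  element : (x : V ℓ) → index x → V ℓ
  element (sup I f) = f

  find : ∀ x y → x ∈ᵛ y → ∃[ i ] x ≈ᵛ element y i
  find x (sup J g) h = h

  -- A member of `f` is recorded by the position of `h ⟨ a ⟩` in `f ⟨ a ⟩`, with `nothing` where it
  -- is not an element. Positions need not respect `~`; they only serve to identify `h` almost
  -- everywhere.
  Eᴬ-setLike : ∀ f → SetLike _Eᴬ_ f
  Eᴬ-setLike f = Σ (∀ a → Maybe (index (f ⟨ a ⟩))) (λ q → Shrink (Coded q)) ,
    (λ (_ , h) → proj₁ (unshrink h)) , (λ (_ , h) → proj₁ (proj₂ (unshrink h))) , covers
    where
    Codes : Fun 𝔹 A → (∀ a → Maybe (index (f ⟨ a ⟩))) → Set (suc ℓ)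
    Codes h q = Almost (λ a → ∃[ i ] q a ≡ just i × h ⟨ a ⟩ ≈ᵛ element (f ⟨ a ⟩) i)

    Coded : (∀ a → Maybe (index (f ⟨ a ⟩))) → Set (suc ℓ)
    Coded q = ∃[ h ] h Eᴬ f × Codes h q

    agree : ∀ h h′ {q} → Codes h q → Codes h′ q → h ≈ᴬ h′
    agree h h′ = Almost-zip λ { (i , e , k) (j , e′ , k′) → unify e e′ k k′ }
      where
      unify : ∀ {a} {m : Maybe (index (f ⟨ a ⟩))} {i j} → m ≡ just i → m ≡ just j →
        h ⟨ a ⟩ ≈ᵛ element (f ⟨ a ⟩) i → h′ ⟨ a ⟩ ≈ᵛ element (f ⟨ a ⟩) j → h ⟨ a ⟩ ≈ᵛ h′ ⟨ a ⟩
      unify refl refl k k′ = ≈ᵛ-trans k (≈ᵛ-sym k′)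

    toMaybe : ∀ x y → Dec (x ∈ᵛ y) → Maybe (index y)
    toMaybe x y (yes h) = just (proj₁ (find x y h))
    toMaybe x y (no _) = nothing

    toMaybe-just : ∀ x y (d : Dec (x ∈ᵛ y)) → x ∈ᵛ y → ∃[ i ] toMaybe x y d ≡ just i × x ≈ᵛ element y i
    toMaybe-just x y (yes h) _ = proj₁ (find x y h) , refl , proj₂ (find x y h)
    toMaybe-just x y (no n) h = ⊥-elim (n h)

    covers : ∀ h → h Eᴬ f → ∃[ j ] _
    covers h k = (coordinates , shrink coded) ,
      (λ g → Eᴬ-respʳ g h h′ h≈) , (λ g → Eᴬ-respʳ g h′ h (≈ᴬ-sym h h′ h≈))
      where
      coordinates : ∀ a → Maybe (index (f ⟨ a ⟩))
      coordinates a = toMaybe (h ⟨ a ⟩) (f ⟨ a ⟩) em₀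

      coded : Coded coordinates
      coded = h , k , Almost-map (λ {a} → toMaybe-just (h ⟨ a ⟩) (f ⟨ a ⟩) em₀) (Eᴬ-to h f k)

      h′ = proj₁ (unshrink (shrink coded))

      h≈ : h ≈ᴬ h′
      h≈ = agree h h′ (proj₂ (proj₂ coded)) (proj₂ (proj₂ (unshrink (shrink coded))))

  module _ (wf : WellFoundedUltrapower 𝔹 U) where

    -- M_A inherits its well-foundedness through π_{A,∞}, here `embed`.
    Eᴬ-Collapse : ∀ f → ∃[ x ] Collapse _Eᴬ_ f x
    Eᴬ-Collapse f = go f (wf (embed f))
      where
      embed : Fun 𝔹 A → Σ (Name 𝔹) (InV̌ 𝔹 U)
      embed f = let ρ , h = represented (checkFun f) in ρ , Represents-InV̌ f h

      go : ∀ f → Acc (λ (σ τ : Σ (Name 𝔹) (InV̌ 𝔹 U)) → proj₁ σ E′ proj₁ τ) (embed f) → ∃[ x ] Collapse _Eᴬ_ f x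
      go f (acc rec) = Collapse-exists _Eᴬ_ (Eᴬ-setLike f) (λ g e →
        go g (rec (Eᴬ-E′ g f (proj₂ (represented (checkFun g))) (proj₂ (represented (checkFun f))) e)))

-- V^𝔹/U is contained in M_A for simple A

module SimpleAntichains {ℓ : Level} (em : ExcludedMiddle (suc ℓ)) (ac : AxiomOfChoice ℓ)
  (𝔹 : CompleteBooleanAlgebra ℓ) (U : Ultrafilter 𝔹) (wf : WellFoundedUltrapower 𝔹 U)
  (A : MaximalAntichain 𝔹) (simple : Simple 𝔹 U A) where

  open Classical em
  open Choice ac
  open BooleanAlgebraProperties em 𝔹
  open BooleanValued em 𝔹
  open Antichains em 𝔹 U
  open Structures em ac 𝔹 U
  open Along A
  open Ultrapowers em ac 𝔹 U A
  open Fun renaming (apply to _⟨_⟩; cong to Fun-cong)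
  open NameFun renaming (apply to _⟪_⟫; cong to NameFun-cong)

  private variable
    s p q z : Carrier
    σ τ ρ : Name 𝔹
    a b : El 𝔹 A

  Respectful : (El 𝔹 A → Carrier) → Set ℓ
  Respectful b = ∀ {a a′} → a ~ a′ → b a ≈ b a′

  codeFun : (b : El 𝔹 A → Carrier) → Respectful b → Fun 𝔹 A
  codeFun b ext = record { apply = code ∘ b ; cong = λ e → code-cong (ext e) }

  Ġ-Glued : (b : El 𝔹 A → Carrier) (ext : Respectful b) →
    Represents σ (checkFun (codeFun b ext)) → σ E′ Ġ 𝔹 → Glued b
  Ġ-Glued {σ} b ext h k = Glued-zip (≗-ext σ (checkFun (codeFun b ext)))
    (λ a u v → ε-elim u λ c t≤s l m → check-≈ (code c) (code (b a))
      (λ e → ≤-trans l (≤-reflexive (code-injective e)))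
      (≗-trans (code c ˇ) σ (code (b a) ˇ) (≗-sym σ (code c ˇ) m) (≤-trans t≤s v)))
    (Glued-const (E′-to σ (Ġ 𝔹) k)) h

  Glued-Ġ : (b : El 𝔹 A → Carrier) (ext : Respectful b) →
    Represents σ (checkFun (codeFun b ext)) → Glued b → σ E′ Ġ 𝔹
  Glued-Ġ {σ} b ext h k = E′-from σ (Ġ 𝔹) (Glued-member
    (Glued-zip {b″ = λ _ → σ ε Ġ 𝔹} (λ e → ≤-reflexive (ext e)) (λ a u v → ε-intro (b a) v u) h k))

  abstract

    generic : Fun 𝔹 A
    generic = proj₁ (proj₁ (proj₂ simple))

  -- generic represents G_A in M_A.
  Generic : El 𝔹 A → Pred Carrier ℓ
  Generic a b = code b ∈ᵛ generic ⟨ a ⟩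

  Generic-ext : ∀ a b → a ~ b → p ≈ q → Generic a p → Generic b q
  Generic-ext a b e e′ = ∈ᵛ-resp (code-cong e′) (Fun-cong generic {a} {b} e)

  abstract

    -- Simplicity speaks of collapsed sets. So `b` is collapsed, found as an element of the set G_A,
    -- pulled back to some `f′` in `generic`, and identified with `f′` by injectivity of the
    -- collapse.
    Glued-Generic : (b : El 𝔹 A → Carrier) → Respectful b →
      Glued b → Almost (λ a → Generic a (b a))
    Glued-Generic b ext h =
      let f = codeFun b ext
          z , (g , colG) , spec = simple
          x , colF = Eᴬ-Collapse wf f
          σ , k = represented (checkFun f)
          f′ , f′∈g , colF′ = Collapse-preimage _Eᴬ_ z colG
            (spec x .from (f , colF , σ , Represents-Value f k , Glued-Ġ b ext k h)) in
      Eᴬ-to f g (Eᴬ-respˡ f′ f g (Eᴬ-Collapse-injective f′ f x colF′ colF) f′∈g)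

    Generic-Glued : (b : El 𝔹 A → Carrier) → Respectful b →
      Almost (λ a → Generic a (b a)) → Glued b
    Generic-Glued b ext h =
      let f = codeFun b ext
          z , (g , colG) , spec = simple
          x , x∈z , colF = Collapse-member _Eᴬ_ z colG (Eᴬ-from f g h)
          f′ , colF′ , σ , v , σ∈Ġ = spec x .to x∈z in
      Ġ-Glued b ext
        (Glued-Almost (λ a e k → ≗-trans σ (f′ ⟨ a ⟩ ˇ) (f ⟨ a ⟩ ˇ) k (check-cong _ _ e))
          (Value-Represents f′ v) (Eᴬ-Collapse-injective f′ f x colF′ colF))
        σ∈Ġ

  ε-cong : ∀ (s t : NameFun) → a ~ b → s ⟪ a ⟫ ε t ⟪ a ⟫ ≈ s ⟪ b ⟫ ε t ⟪ b ⟫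
  ε-cong s t e = antisym (ε-ext s t e) (ε-ext s t (≈-sym e))

  Glued-E : ∀ (s t : NameFun) →
    Glued (λ a → s ⟪ a ⟫ ε t ⟪ a ⟫) → Almost (λ a → E[ Generic a ] (s ⟪ a ⟫) (t ⟪ a ⟫))
  Glued-E s t h = Almost-map (λ {a} → E-from (Generic a) (s ⟪ a ⟫) (t ⟪ a ⟫))
    (Glued-Generic _ (ε-cong s t) h)

  E-Glued : ∀ (s t : NameFun) →
    Almost (λ a → E[ Generic a ] (s ⟪ a ⟫) (t ⟪ a ⟫)) → Glued (λ a → s ⟪ a ⟫ ε t ⟪ a ⟫)
  E-Glued s t h = Generic-Glued _ (ε-cong s t)
    (Almost-map (λ {a} → E-to (Generic a) (s ⟪ a ⟫) (t ⟪ a ⟫)) h)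

  -- From counterexamples (p, q, z) chosen at almost all `a`, the functions p and q are glued, hence
  -- so is z, which puts z into `Generic a` almost everywhere after all.
  Generic-isFilter : Almost (λ a → Lift (suc ℓ) (IsFilter (Generic a)))
  Generic-isFilter = Almost-dne
    (λ {a} {b} e (lift h) → lift λ k l m → Generic-ext a b e ≈-refl
      (h (Generic-ext b a (≈-sym e) ≈-refl k) (Generic-ext b a (≈-sym e) ≈-refl l) m))
    (λ gap →
      let wit = Almost-map (λ {a} n → lower (spec a (counterexample n))) gap
          k = Generic-Glued (fst ∘ t) (λ {a} {b} e → t-ext₁ a b e) (Almost-map proj₁ wit)
          l = Generic-Glued (snd ∘ t) (λ {a} {b} e → t-ext₂ a b e) (Almost-map (proj₁ ∘ proj₂) wit)
          m = Glued-zip (λ {a} {b} e → ≤-reflexive (t-ext₂ a b e)) (λ a → ∧-greatest) k l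
          n = Glued-Almost (λ a below h → ≤-trans h below) m (Almost-map (proj₁ ∘ proj₂ ∘ proj₂) wit) in
      ¬Almost-empty (Almost-zip (λ h w → proj₂ (proj₂ (proj₂ w)) h)
        (Glued-Generic (thd ∘ t) (λ {a} {b} e → t-ext₃ a b e) n) wit))
    where
    Triple : Set ℓ
    Triple = Carrier × Carrier × Carrier

    fst snd thd : Triple → Carrier
    fst (p , _ , _) = p
    snd (_ , q , _) = q
    thd (_ , _ , z) = z

    Counterexample : El 𝔹 A → Triple → Set (suc ℓ)
    Counterexample a (p , q , z) = Lift (suc ℓ) (Generic a p × Generic a q × p ∧ q ≤ z × ¬ Generic a z)

    ext : ∀ {a b} → code (proj₁ a) ≈ᵛ code (proj₁ b) → ∀ {t} → Counterexample a t → Counterexample b t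
    ext {a} {b} e (lift (k , l , m , n)) = let e = code-injective e in
      lift (Generic-ext a b e ≈-refl k , Generic-ext a b e ≈-refl l , m ,
        λ o → n (Generic-ext b a (≈-sym e) ≈-refl o))

    counterexample : ∀ {a} → ¬ Lift (suc ℓ) (IsFilter (Generic a)) → ∃ (Counterexample a)
    counterexample n = dne (λ none → n (lift (λ {p} {q} {z} k l m →
      dne₀ (λ o → none ((p , q , z) , lift (k , l , m , o))))))

    -- The triple is chosen as a whole, so that its components belong together and each respects
    -- `~`.
    chosen = choose (code ∘ proj₁) (λ (p , q , z) → opair (code p) (opair (code q) (code z)))
      (⊤ , ⊤ , ⊤) Counterexample (λ _ → em) (λ {a} {b} → ext {a} {b})

    t : El 𝔹 A → Triple
    t = proj₁ chosen

    t-ext = proj₁ (proj₂ chosen)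
    spec = proj₂ (proj₂ chosen)

    t-ext₁ : ∀ a b → a ~ b → fst (t a) ≈ fst (t b)
    t-ext₁ a b e = code-injective (opair-injectiveˡ (t-ext a b (code-cong e)))

    t-ext₂ : ∀ a b → a ~ b → snd (t a) ≈ snd (t b)
    t-ext₂ a b e = code-injective (opair-injectiveˡ (opair-injectiveʳ (t-ext a b (code-cong e))))

    t-ext₃ : ∀ a b → a ~ b → thd (t a) ≈ thd (t b)
    t-ext₃ a b e = code-injective (opair-injectiveʳ (opair-injectiveʳ (t-ext a b (code-cong e))))

  E-ext : ∀ (s t : NameFun) → a ~ b → E[ Generic a ] (s ⟪ a ⟫) (t ⟪ a ⟫) → E[ Generic b ] (s ⟪ b ⟫) (t ⟪ b ⟫)
  E-ext {a} {b} s t e h = E-from (Generic b) (s ⟪ b ⟫) (t ⟪ b ⟫)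
    (Generic-ext a b e (ε-cong s t e) (E-to (Generic a) (s ⟪ a ⟫) (t ⟪ a ⟫) h))

  Collapses : El 𝔹 A → Name 𝔹 → V ℓ → Set (suc ℓ)
  Collapses a = Collapse E[ Generic a ]

  Collapses-≗ : a ~ b → ⊤ ≤ σ ≗ τ → ∀ x → Collapses a σ x → Collapses b τ x
  Collapses-≗ {a} {b} e h x = Collapse-bisim E[ Generic a ] E[ Generic b ] (λ σ τ → ⊤ ≤ σ ≗ τ)
    (λ {σ} {τ} {ρ} h k → ρ , transfer a b e ρ h k , ≗-refl ρ)
    (λ {σ} {τ} {ρ} h k → ρ , transfer b a (≈-sym e) ρ (≗-sym σ τ h) k , ≗-refl ρ) x h
    where
    transfer : ∀ a b → a ~ b → ∀ ρ → ⊤ ≤ σ ≗ τ → E[ Generic a ] ρ σ → E[ Generic b ] ρ τ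
    transfer {σ} {τ} a b e ρ h k = E-from (Generic b) ρ τ (Generic-ext a b e
      (antisym (ε-respʳ ρ σ τ (≤-trans (maximum _) h) ≤-refl)
               (ε-respʳ ρ τ σ (≗-sym σ τ (≤-trans (maximum _) h)) ≤-refl))
      (E-to (Generic a) ρ σ k))

  Collapses-ext : ∀ (s : NameFun) → a ~ b → ∀ x → Collapses a (s ⟪ a ⟫) x → Collapses b (s ⟪ b ⟫) x
  Collapses-ext s e = Collapses-≗ e (NameFun-cong s e)

  -- Where `s ⟪ a ⟫` has no collapse, some member of it has none. Such members mix to an element of
  -- `σ`, whose collapse is an element of `x`, and the induction hypothesis contradicts the choice.
  Represents-Collapses : ∀ x (s : NameFun) → Represents σ s → Collapse _E′_ σ x →
    Almost (λ a → ∃ (Collapses a (s ⟪ a ⟫)))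
  Represents-Collapses {σ} (sup I f) s h (forth , _) = Almost-dne
    (λ e (x , c) → x , Collapses-ext s e x c)
    (λ bad →
      let t , spec = chooseName (λ a τ → E[ Generic a ] τ (s ⟪ a ⟫) × ¬ ∃ (Collapses a τ))
            (λ {τ} e (k , n) → E-ext (constᴺ τ) s e k ,
              λ (x , c) → n (x , Collapses-ext (constᴺ τ) (≈-sym e) x c))
          wit = Almost-zip (λ {a} (lift isFilter) n → spec a (dne λ none → n
            (Collapse-exists E[ Generic a ] (E-setLike (Generic a) isFilter (s ⟪ a ⟫))
              (λ τ k → dne λ m → none (τ , k , m))))) Generic-isFilter bad
          τ , k = represented t
          i , c = forth τ (Glued-E′ {s = t} {s} k h (E-Glued t s (Almost-map proj₁ wit))) in
      ¬Almost-empty (Almost-zip (λ w c → proj₂ w c) wit (Represents-Collapses (f i) t k c)))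

  -- A bisimulation between V^𝔹/U and M_A. The name may vary with `a`, since going back from M_A
  -- picks a different member for each `a`.
  Matches : Name 𝔹 → Fun 𝔹 A → Set (suc ℓ)
  Matches σ y = Σ[ s ∈ NameFun ] Represents σ s × Almost (λ a → Collapses a (s ⟪ a ⟫) (y ⟨ a ⟩))

  Matches-forth : ∀ {y} → Matches σ y → τ E′ σ → ∃[ y′ ] y′ Eᴬ y × Matches τ y′
  Matches-forth {σ} {τ} {y} (s , h , k) e =
    let t = constᴺ τ
        t≗ = Represents-const τ
        y′ , spec = chooseFun (λ a v → Lift (suc ℓ) (v ∈ᵛ y ⟨ a ⟩) × Collapses a τ v)
          (λ {v} {a} {b} e (lift l , m) → lift (∈ᵛ-respʳ (Fun-cong y {a} {b} e) l) , Collapses-ext t e v m)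
        wit = Almost-zip
          (λ {a} l c → spec a (let v , v∈ , d = Collapse-member E[ Generic a ] _ c l in v , lift v∈ , d))
          (Glued-E t s (E′-Glued {s = t} {s} t≗ h e)) k in
    y′ , Eᴬ-from y′ y (Almost-map (lower ∘ proj₁) wit) , t , t≗ , Almost-map proj₂ wit

  Matches-back : ∀ {y y′} → Matches σ y → y′ Eᴬ y → ∃[ τ ] τ E′ σ × Matches τ y′
  Matches-back {σ} {y} {y′} (s , h , k) e =
    let t , spec = chooseName (λ a τ → E[ Generic a ] τ (s ⟪ a ⟫) × Collapses a τ (y′ ⟨ a ⟩))
          (λ {τ} {a} {b} e (l , m) → E-ext (constᴺ τ) s e l ,
            Collapse-resp E[ Generic b ] _ _ (Fun-cong y′ {a} {b} e) (Collapses-ext (constᴺ τ) e _ m))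
        wit = Almost-zip (λ {a} l c → spec a (Collapse-preimage E[ Generic a ] _ c l)) (Eᴬ-to y′ y e) k
        τ , l = represented t in
    τ , Glued-E′ {s = t} {s} l h (E-Glued t s (Almost-map proj₁ wit)) , t , l , Almost-map proj₂ wit

  Matches-to : ∀ x {y} → Matches σ y → Collapse _E′_ σ x → Collapse _Eᴬ_ y x
  Matches-to = λ x → Collapse-bisim _E′_ _Eᴬ_ Matches
    (λ {_} {y} → Matches-forth {y = y}) (λ {_} {y} {y′} → Matches-back {y = y} {y′}) x

  Matches-from : ∀ x {y} → Matches σ y → Collapse _Eᴬ_ y x → Collapse _E′_ σ x
  Matches-from = λ x → Collapse-bisim _Eᴬ_ _E′_ (λ y σ → Matches σ y)
    (λ {y} {_} {y′} → Matches-back {y = y} {y′}) (λ {y} → Matches-forth {y = y}) x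

  Collapse-matched : ∀ x → Collapse _E′_ σ x →
    ∃[ y ] Almost (λ a → Collapses a σ (y ⟨ a ⟩)) × Collapse _Eᴬ_ y x
  Collapse-matched {σ} x c =
    let y , spec = chooseFun (λ a → Collapses a σ) (λ {v} e → Collapses-ext (constᴺ σ) e v)
        wit = Almost-map (λ {a} → spec a) (Represents-Collapses x (constᴺ σ) (Represents-const σ) c) in
    y , wit , Matches-to x (constᴺ σ , Represents-const σ , wit) c

  V^𝔹/U⊆M : V^𝔹/U 𝔹 U ⊆ M 𝔹 U A
  V^𝔹/U⊆M {x} (σ , c) = let y , _ , d = Collapse-matched x c in y , d

-- The intersection along a simple skeleton is contained in V^𝔹/U

module SimpleSkeletons {ℓ : Level} (em : ExcludedMiddle (suc ℓ)) (ac : AxiomOfChoice ℓ)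
  (𝔹 : CompleteBooleanAlgebra ℓ) (U : Ultrafilter 𝔹) (wf : WellFoundedUltrapower 𝔹 U)
  (skeleton : Skeleton 𝔹 U) (simple : ∀ k → Simple 𝔹 U (Skeleton.𝔄 skeleton k)) where

  open Classical em
  open Choice ac
  open BooleanAlgebraProperties em 𝔹
  open BooleanValued em 𝔹
  open Antichains em 𝔹 U
  open Structures em ac 𝔹 U
  open Skeleton skeleton
  open Fun renaming (apply to _⟨_⟩; cong to Fun-cong)

  module At (k : K) where
    open Along (𝔄 k) public
    open Ultrapowers em ac 𝔹 U (𝔄 k) public
    open SimpleAntichains em ac 𝔹 U wf (𝔄 k) (simple k) public

  J : Name 𝔹
  J = proj₁ (proj₁ (proj₂ j[𝔄]∈))

  J-Collapse : Collapse _E′_ J (proj₁ j[𝔄]∈)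
  J-Collapse = proj₂ (proj₁ (proj₂ j[𝔄]∈))

  Ǎ : K → Name 𝔹
  Ǎ k = asSet 𝔹 (𝔄 k) ˇ

  Ǎ∈J : ∀ k → member (Ǎ k ε J)
  Ǎ∈J k =
    let x , c = InV̌-Collapse wf (Ǎ k) (check-InV̌ (asSet 𝔹 (𝔄 k)))
        τ , e , d = Collapse-preimage _E′_ _ J-Collapse (proj₂ (proj₂ j[𝔄]∈) x .from (k , c)) in
    E′-to (Ǎ k) J (E-respˡ member member-isFilter J (E′-Collapse-injective x d c) e)

  J-element : ∀ τ → τ E′ J → ∃[ k ] member (τ ≗ Ǎ k)
  J-element τ e =
    let x , x∈ , c = Collapse-member _E′_ _ J-Collapse e
        k , d = proj₂ (proj₂ j[𝔄]∈) x .to x∈ in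
    k , E′-Collapse-injective x c d

  -- This is where j[𝔄] ∈ V^𝔹/U is used: U need not be closed under meets over
  -- K, but it is once these are relativized to the name J of j[𝔄].
  ⋀-member : (e : K → Carrier) → (∀ k l → asSet 𝔹 (𝔄 k) ≈ᵛ asSet 𝔹 (𝔄 l) → e k ≤ e l) →
    (∀ k → member (e k)) → member (⋀ (λ k → Ǎ k ε J ⇨ e k))
  ⋀-member e ext h = member-dne λ n →
    -- The failing antichains are glued to one element `τ` of `J`, which must be some `Ǎ k`.
    -- Wherever `τ` is also `Ǎ k′`, the two antichains coincide, so by `ext` the failure of `e k′`
    -- clashes with `e k` being in `U`.
    let τ , l = glue gap Ǎ (upward (failure ≤-refl) n)
        k , m = J-element τ (E′-from τ J (upward (⋁-least λ k →
          ε-respˡ (Ǎ k) τ J (≗-sym τ (Ǎ k) (x∧y≤y _ _)) (∧-fst (x∧y≤x _ _))) l)) in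
    proper (member-∧ (λ u v → ⋁-elim u λ k′ s≤r w →
      check-≈ (asSet 𝔹 (𝔄 k)) (asSet 𝔹 (𝔄 k′))
        (λ eq → ∁-elim (∧-snd (∧-fst w)) (≤-trans s≤r (≤-trans (∧-snd v) (ext k k′ eq))))
        (≗-trans (Ǎ k) τ (Ǎ k′) (≗-sym τ (Ǎ k) (≤-trans s≤r (∧-fst v))) (∧-snd w)))
      l (∧-closed m (h k)))
    where
    gap : K → Carrier
    gap k = Ǎ k ε J ∧ ∁ e k

    failure : ∀ {r} → r ≤ ∁ ⋀ (λ k → Ǎ k ε J ⇨ e k) → r ≤ ⋁ gap
    failure h = ∁-cases (⋁ gap) (λ _ l → l) (λ s≤r l → ∁-elim (≤-trans s≤r h)
      (⋀-greatest λ k → ⇨-intro λ t≤s m → ∁-cases (e k) (λ _ n → n)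
        (λ u≤t n → ∁-elim (≤-trans u≤t (≤-trans t≤s l)) (⋁-upper gap k (∧-greatest (≤-trans u≤t m) n)))))

  module _ {I : Set ℓ} (f : I → V ℓ) (ν : I → Name 𝔹) (ν-Collapse : ∀ i → Collapse _E′_ (ν i) (f i))
    (φ : ∀ k → Fun 𝔹 (𝔄 k)) (φ-Collapse : ∀ k → Collapse (Eᵁ 𝔹 U (𝔄 k)) (φ k) (sup I f)) where

    Holds : ∀ k → El 𝔹 (𝔄 k) → Name 𝔹 → Set (suc ℓ)
    Holds k a σ = ∃[ y ] Lift (suc ℓ) (y ∈ᵛ φ k ⟨ a ⟩) × At.Collapses k a σ y

    value : K → I → Carrier
    value k i = ⋁ {I = Σ[ a ∈ El 𝔹 (𝔄 k) ] Shrink (Holds k a (ν i))} (proj₁ ∘ proj₁)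

    -- In M_A, the function of pointwise collapses of `ν i` has the same collapse `f i` as some
    -- element of `φ k`, and so is almost everywhere a member of `φ k`.
    value-member : ∀ k i → member (value k i)
    value-member k i =
      let y , c , d = At.Collapse-matched k (f i) (ν-Collapse i)
          z , z∈φ , d′ = proj₂ (φ-Collapse k) i
          y∈φ = At.Eᴬ-respˡ k z y (φ k) (At.Eᴬ-Collapse-injective k z y (f i) d′ d) z∈φ in
      At.Almost-InU k (At.Almost-zip k (λ {a} c y∈ → shrink (y ⟨ a ⟩ , lift y∈ , c)) c (At.Eᴬ-to k y (φ k) y∈φ))

    -- F makes φ and generic depend on the antichain 𝔄 k only, and not on k.
    abstract

      selected : Σ[ F ∈ (K → K) ] (∀ k → asSet 𝔹 (𝔄 (F k)) ≈ᵛ asSet 𝔹 (𝔄 k)) ×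
        (∀ k l → asSet 𝔹 (𝔄 k) ≈ᵛ asSet 𝔹 (𝔄 l) →
          opair (graph 𝔹 (φ (F k))) (graph 𝔹 (At.generic (F k))) ≈ᵛ
          opair (graph 𝔹 (φ (F l))) (graph 𝔹 (At.generic (F l))))
      selected = selector (asSet 𝔹 ∘ 𝔄) (λ k → opair (graph 𝔹 (φ k)) (graph 𝔹 (At.generic k)))

    F : K → K
    F = proj₁ selected

    graph-transfer : ∀ k l (g : Fun 𝔹 (𝔄 k)) (h : Fun 𝔹 (𝔄 l)) → graph 𝔹 g ≈ᵛ graph 𝔹 h → ∀ a →
      ∃[ b ] proj₁ a ≈ proj₁ b × g ⟨ a ⟩ ≈ᵛ h ⟨ b ⟩
    graph-transfer k l g h (p , _) a = let b , e = p a in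
      b , code-injective (opair-injectiveˡ e) , opair-injectiveʳ e

    Holds-transfer : ∀ k l → asSet 𝔹 (𝔄 k) ≈ᵛ asSet 𝔹 (𝔄 l) → ∀ a σ → Holds (F k) a σ →
      ∃[ b ] proj₁ a ≈ proj₁ b × Holds (F l) b σ
    Holds-transfer k l e a σ (y , lift y∈ , c) =
      let e′ = proj₂ (proj₂ selected) k l e
          b , a~b , φ≈ = graph-transfer (F k) (F l) (φ (F k)) (φ (F l)) (opair-injectiveˡ e′) a
          b′ , a~b′ , g≈ =
            graph-transfer (F k) (F l) (At.generic (F k)) (At.generic (F l)) (opair-injectiveʳ e′) a
          g≈′ = ≈ᵛ-trans g≈ (Fun-cong (At.generic (F l)) {b′} {b} (≈-trans (≈-sym a~b′) a~b)) in
      b , a~b , y , lift (∈ᵛ-respʳ φ≈ y∈) ,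
        Collapse-bisim E[ At.Generic (F k) a ] E[ At.Generic (F l) b ] _≡_
          (λ { refl h → _ , ∈ᵛ-respʳ g≈′ h , refl })
          (λ { refl h → _ , ∈ᵛ-respʳ (≈ᵛ-sym g≈′) h , refl }) y refl c

    value-ext : ∀ i k l → asSet 𝔹 (𝔄 k) ≈ᵛ asSet 𝔹 (𝔄 l) → value (F k) i ≤ value (F l) i
    value-ext i k l e = ⋁-least λ (a , h) → let b , a~b , h′ = Holds-transfer k l e a (ν i) (unshrink h) in
      ⋁-upper _ (b , shrink h′) (≤-reflexive a~b)

    -- The Boolean value of: every A ∈ J recognizes ν i as an element of sup I f.
    coefficient : I → Carrier
    coefficient i = ⋀ (λ k → Ǎ k ε J ⇨ value (F k) i)

    union : Name 𝔹
    union = name I ν coefficient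

    union-entry : ∀ i → ν i E′ union
    union-entry i = E′-from (ν i) union (upward (ε-intro i ≤-refl (≗-refl (ν i)))
        (⋀-member (λ k → value (F k) i) (value-ext i) (λ k → value-member (F k) i)))

    union-element : ∀ σ → σ E′ union → ∃[ i ] Collapse _E′_ σ (f i)
    union-element σ σ∈ =
      let i , d = proj₁ (φ-Collapse m) y (Eᴬ-from y (φ m) (Almost-map (lower ∘ proj₁) wit)) in
      i , Matches-from (f i) (s , σ≗s , Almost-map proj₂ wit) d
      where
      candidate : I → Carrier
      candidate i = coefficient i ∧ σ ≗ ν i

      glued : ∃[ ι ] member (⋁ (λ i → candidate i ∧ ι ≗ codeᴺ (ν i) ˇ))
      -- The type `I` has no coding into V, so the entry equal to `σ` is pointed at by the code of
      -- its name; this fixes `ν i` up to value `⊤`.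
      glued = glue candidate (λ i → codeᴺ (ν i) ˇ)
        (upward (ε-elim ≤-refl λ i _ h k → ⋁-upper _ i (∧-greatest h k)) (E′-to σ union σ∈))

      ι = proj₁ glued
      ι-candidate = proj₂ glued

      ι-value : ∃[ k ] Σ[ h ∈ Fun 𝔹 (𝔄 k) ] Value 𝔹 U h ι
      ι-value = generate ι .to (InV̌-from ι (upward (⋁-least λ i → inV-upper _ (x∧y≤y _ _)) ι-candidate))

      k = proj₁ ι-value
      -- The coefficients weigh `value (F k)`, so the argument takes place at `F k`; since it lists
      -- the same antichain, `h` can be moved there.
      m = F k
      h = proj₁ (proj₂ ι-value)
      open At m

      same : asSet 𝔹 (𝔄 m) ≈ᵛ asSet 𝔹 (𝔄 k)
      same = proj₁ (proj₂ selected) k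

      move : El 𝔹 (𝔄 m) → El 𝔹 (𝔄 k)
      move a = proj₁ (proj₁ same a)

      move-≈ : ∀ a → proj₁ a ≈ proj₁ (move a)
      move-≈ a = code-injective (proj₂ (proj₁ same a))

      h′ : Fun 𝔹 (𝔄 m)
      h′ = record { apply = λ a → h ⟨ move a ⟩
                  ; cong = λ {a} {b} e → Fun-cong h (≈-trans (≈-sym (move-≈ a)) (≈-trans e (move-≈ b))) }

      ι≗h′ : Represents ι (checkFun h′)
      ι≗h′ = upward (⋁-map λ a →
          let b , e = proj₂ same a
              b≈a = code-injective e in
          b , ∧-mono (≤-reflexive (≈-sym b≈a))
            (≗-trans ι (h ⟨ a ⟩ ˇ) (h ⟨ move b ⟩ ˇ) ≤-refl
              (check-cong _ _ (Fun-cong h {a} {move b} (≈-trans (≈-sym b≈a) (move-≈ b))))))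
        (At.Value-Represents k h (proj₂ (proj₂ ι-value)))

      decoded = chooseName (λ a τ → Lift (suc ℓ) (codeᴺ τ ≈ᵛ h′ ⟨ a ⟩))
        (λ {τ} {a} {b} e (lift p) → lift (≈ᵛ-trans p (Fun-cong h′ {a} {b} e)))

      s : NameFun
      s = proj₁ decoded

      s-spec : ∀ a {i} → codeᴺ (ν i) ≈ᵛ h′ ⟨ a ⟩ → ∀ {r} → r ≤ NameFun.apply s a ≗ ν i
      s-spec a {i} e = codeᴺ-≈ _ (ν i) (≈ᵛ-trans (lower (proj₂ decoded a (ν i , lift e))) (≈ᵛ-sym e))

      -- Below `a`, the index `ι` is both the code of some `ν i` and `h′ ⟨ a ⟩`. Being checks, these
      -- are then truly equal, so the decoded name at `a` is `ν i` with value `⊤`.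
      combine : ∀ {p b} → member p →
        (∀ a i {r} → r ≤ p → r ≤ candidate i → (∀ {r} → r ≤ NameFun.apply s a ≗ ν i) → r ≤ b a) →
        Glued b
      combine hp step = member-∧
        (λ u v → ⋁-elim u λ i s≤r w → ⋁-elim (≤-trans s≤r (∧-fst v)) λ a t≤s x →
          let w = ≤-trans t≤s w in
          check-≈ (codeᴺ (ν i)) (h′ ⟨ a ⟩)
            (λ e → ⋁-upper _ a (∧-greatest (∧-fst x)
              (step a i (≤-trans t≤s (≤-trans s≤r (∧-snd v))) (∧-fst w) (s-spec a e))))
            (≗-trans (codeᴺ (ν i) ˇ) ι (h′ ⟨ a ⟩ ˇ) (≗-sym ι (codeᴺ (ν i) ˇ) (∧-snd w)) (∧-snd x)))
        ι-candidate (∧-closed ι≗h′ hp)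

      σ≗s : Represents σ s
      σ≗s = combine ⊤-member λ a i _ c e → ≗-trans σ (ν i) _ (∧-snd c) (≗-sym _ (ν i) e)

      s-value : El 𝔹 (𝔄 m) → Carrier
      s-value a = ⋁ {I = Σ[ i ∈ I ] ⊤ ≤ NameFun.apply s a ≗ ν i} (value m ∘ proj₁)

      s-holds : Almost (λ a → Holds m a (NameFun.apply s a))
      s-holds = Almost-Glued {b = s-value}
        (λ {a} {b} e (y , lift y∈ , c) →
          y , lift (∈ᵛ-respʳ (Fun-cong (φ m) {a} {b} e) y∈) , Collapses-ext s e y c)
        (λ a n r≤a h → ⋁-elim h λ (i , e) s≤r u → ⋁-elim u λ (b , holds) t≤s v →
          meet-cases {a = a} {b} (≤-trans t≤s (≤-trans s≤r r≤a)) v λ a~b →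
            let y , lift y∈ , c = unshrink holds in
            ⊥-elim (n (y , lift (∈ᵛ-respʳ (Fun-cong (φ m) {b} {a} (≈-sym a~b)) y∈) ,
              Collapses-≗ (≈-sym a~b) (≗-sym _ (ν i) e) y c)))
        -- `coefficient i` is a meet over all antichains in `J`; as `Ǎ k` is one of them, its
        -- conjunct at `k` yields `value m i`.
        (combine (Ǎ∈J k) λ a i u c e → ⋁-upper _ (i , e) (⇨-elim (⋀-lower k (∧-fst c)) u))

      chosen = chooseFun (λ a v → Lift (suc ℓ) (v ∈ᵛ φ m ⟨ a ⟩) × Collapses a (NameFun.apply s a) v)
        (λ {v} {a} {b} e (lift v∈ , c) → lift (∈ᵛ-respʳ (Fun-cong (φ m) {a} {b} e) v∈) , Collapses-ext s e v c)

      y = proj₁ chosen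
      wit = Almost-map (λ {a} → proj₂ chosen a) s-holds

    union-Collapse : Collapse _E′_ union (sup I f)
    union-Collapse = union-element , λ i → ν i , union-entry i , ν-Collapse i

  -- Induction on membership: the models M_A are transitive, so each element of `x` again lies in
  -- all of them and already has a name.
  ⋂M⊆V^𝔹/U : ∀ x → (∀ k → M 𝔹 U (𝔄 k) x) → V^𝔹/U 𝔹 U x
  ⋂M⊆V^𝔹/U (sup I f) h = _ , union-Collapse f (proj₁ ∘ ih) (proj₂ ∘ ih) (proj₁ ∘ h) (proj₂ ∘ h)
    where
    ih : ∀ i → V^𝔹/U 𝔹 U (f i)
    ih i = ⋂M⊆V^𝔹/U (f i) (λ k → let g , _ , c = proj₂ (proj₂ (h k)) i in g , c)

theorem3p10 : (ℓ : Level) → ExcludedMiddle (suc ℓ) → AxiomOfChoice ℓ →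
    (𝔹 : CompleteBooleanAlgebra ℓ) (U : Ultrafilter 𝔹) →
    WellFoundedUltrapower 𝔹 U →
    SimpleSkeleton 𝔹 U →
    (V^𝔹/U 𝔹 U ≐ ⋂ (Σ (MaximalAntichain 𝔹) (Simple 𝔹 U)) (λ A → M 𝔹 U (proj₁ A)))
    × ((∀ A → Simple 𝔹 U A) → V^𝔹/U 𝔹 U ≐ ⋂ (MaximalAntichain 𝔹) (M 𝔹 U))
theorem3p10 ℓ em ac 𝔹 U wf (skeleton , simple) =
  ( (λ h (A , A-simple) → V^𝔹/U⊆M A A-simple h)
  , (λ h → ⋂M⊆V^𝔹/U _ (λ k → h (Skeleton.𝔄 skeleton k , simple k))) ) ,
  λ all-simple →
    (λ h A → V^𝔹/U⊆M A (all-simple A) h) ,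
    (λ h → ⋂M⊆V^𝔹/U _ (λ k → h (Skeleton.𝔄 skeleton k)))
  where
  open SimpleAntichains em ac 𝔹 U wf using (V^𝔹/U⊆M)
  open SimpleSkeletons em ac 𝔹 U wf skeleton simple using (⋂M⊆V^𝔹/U)
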